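{- Let $\Gamma=(G,\sigma)$ be a connected signed graph, let $uv$ be a non-pendant edge of $\Gamma$ that lies in no triangle, and let $\Gamma'=\alpha(\Gamma,uv)$ be the graph obtained from $\Gamma$ by the $\alpha$-transform on the edge $uv$. Let $\mathbf x$ be an eigenvector of $A(\Gamma)$ corresponding to the index $\lambda(\Gamma)$. If one of the following conditions holds, then $\lambda(\Gamma')\ge\lambda(\Gamma)$: (1) $\sigma(uv)>0$ and $x_v\le x_u\le\lambda(\Gamma)x_v$; (2) $\sigma(uv)<0$ and $x_u\ge 0$, $x_v\ge 0$. Furthermore, if one of the following conditions holds, then $\lambda(\Gamma')>\lambda(\Gamma)$: (1) $\sigma(uv)>0$ and $x_v<x_u<\lambda(\Gamma)x_v$; (2) $\sigma(uv)<0$, $x_u>0$, $x_v>0$ and $x_u\ne x_v$.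
   Context: A signed graph $\Gamma=(G,\sigma)$ is a finite simple graph $G$ with a map $\sigma:E(G)\to\{+1,-1\}$. Its adjacency matrix $A(\Gamma)$ has $(u,v)$ entry $\sigma(uv)$ if $uv\in E(G)$ and $0$ otherwise; the index $\lambda(\Gamma)$ is the largest eigenvalue of $A(\Gamma)$. For a vector $\mathbf x$ indexed by vertices, $x_u$ is its entry at $u$. $\alpha$-transform: let $\Gamma$ be a connected signed graph and $uv$ a non-pendant edge (neither end has degree 1) which is not in any triangle. Let $N_\Gamma(v)\setminus\{u\}=\{v_1,\dots,v_d\}$ with $d\ge 1$. Then $$\alpha(\Gamma,uv)=\Gamma-vv_1-\cdots-vv_d+uv_1+\cdots+uv_d,$$ where all edges retain their signs (the new edge $uv_i$ has sign $\sigma(vv_i)$; the edge $uv$ is kept with its sign). -}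

module Defs where

open import Algebra.Apartness.Bundles using (HeytingField)
open import Algebra.Bundles using (CommutativeRing)
open import Data.Fin.Base using (Fin)
open import Data.Fin.Properties using (_≟_)
open import Data.List.Base using (length; filter; allFin)
open import Data.Maybe using (Maybe; just; nothing; _<∣>_; maybe′; Is-just)
open import Data.Maybe.Relation.Unary.Any using (dec)
open import Data.Nat.Base using (ℕ)
open import Data.Product.Base using (∃; _×_)
open import Data.Sign.Base using (Sign)
open import Data.Sum.Base using (_⊎_)
open import Data.Unit.Base using (tt)
open import Data.Vec.Functional using (Vector)
open import Function.Bundles using (_⇔_)
open import Level using (_⊔_; suc)
open import Relation.Binary.Construct.Closure.ReflexiveTransitive using (Star)
open import Relation.Binary.Core using (Rel)
open import Relation.Binary.PropositionalEquality using (_≡_; _≢_; refl)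
open import Relation.Binary.Structures using (IsStrictPartialOrder)
open import Relation.Nullary using (¬_; Dec; yes; no)
open import Relation.Unary using (Pred; _∈_; Satisfiable)
import Algebra.Definitions.RawMonoid as RawMonoidDefs

-- The standard library has no real numbers, so they are axiomatised as
-- an ordered field in which every inhabited, bounded-above set has a
-- supremum.  The axioms are the constructive ones: x ≤ y means
-- ¬ (y < x), x # y (x < y or y < x) is the positive form of x ≠ y, and
-- the supremum axiom asks that the set be order-located.  With excluded
-- middle, # is ¬ ≈, < is total and every set is located, so the models
-- are then exactly the Dedekind-complete ordered fields, that is, ℝ.

record Reals c ℓ₁ ℓ₂ : Set (suc (c ⊔ ℓ₁ ⊔ ℓ₂)) where
  infix 4 _<_ _≤_
  field
    heytingField : HeytingField c ℓ₁ ℓ₂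

  open HeytingField heytingField public

  commutativeRing : CommutativeRing c ℓ₁
  commutativeRing = record { isCommutativeRing = isCommutativeRing }

  field
    _<_                  : Rel Carrier ℓ₂
    isStrictPartialOrder : IsStrictPartialOrder _≈_ _<_
    #⇔<⊎>                : ∀ {x y} → x # y ⇔ (x < y ⊎ y < x)
    +-monoʳ-<            : ∀ x {y z} → y < z → x + y < x + z
    *-pos                : ∀ {x y} → 0# < x → 0# < y → 0# < x * y

  _≤_ : Rel Carrier ℓ₂
  x ≤ y = ¬ (y < x)

  UpperBound : ∀ {ℓ} → Pred Carrier ℓ → Pred Carrier (c ⊔ ℓ₂ ⊔ ℓ)
  UpperBound S b = ∀ s → s ∈ S → s ≤ b

  HasElementAbove : ∀ {ℓ} → Pred Carrier ℓ → Pred Carrier (c ⊔ ℓ₂ ⊔ ℓ)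
  HasElementAbove S a = ∃ λ s → s ∈ S × a < s

  IsSupremum : ∀ {ℓ} → Pred Carrier ℓ → Pred Carrier (c ⊔ ℓ₂ ⊔ ℓ)
  IsSupremum S b = UpperBound S b × (∀ a → a < b → HasElementAbove S a)

  Located : ∀ {ℓ} → Pred Carrier ℓ → Set (c ⊔ ℓ₂ ⊔ ℓ)
  Located S = ∀ a b → a < b → HasElementAbove S a ⊎ UpperBound S b

  field
    supremum : (S : Pred Carrier (c ⊔ ℓ₁ ⊔ ℓ₂)) → Satisfiable S →
               Satisfiable (UpperBound S) → Located S → ∃ (IsSupremum S)

-- label x y is just s if xy is an edge of sign s, and nothing if x and y
-- are not adjacent: the edge set and the sign function in one map.

record SignedGraph (n : ℕ) : Set where
  field
    label        : Fin n → Fin n → Maybe Sign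
    label-sym    : ∀ x y → label x y ≡ label y x
    label-irrefl : ∀ x → label x x ≡ nothing

  Edge : Fin n → Fin n → Set
  Edge x y = Is-just (label x y)

  edge? : ∀ x y → Dec (Edge x y)
  edge? x y = dec (λ _ → yes tt) (label x y)

  degree : Fin n → ℕ
  degree x = length (filter (edge? x) (allFin n))

  Connected : Set
  Connected = ∀ x y → Star Edge x y

  NonPendant : Fin n → Fin n → Set
  NonPendant x y = degree x ≢ 1 × degree y ≢ 1

  InNoTriangle : Fin n → Fin n → Set
  InNoTriangle x y = ∀ w → ¬ (Edge x w × Edge w y)

data Role : Set where
  is-u is-v other : Role

role : ∀ {n} → Fin n → Fin n → Fin n → Role
role u v x with x ≟ u | x ≟ v
... | yes _ | _     = is-u
... | no _  | yes _ = is-v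
... | no _  | no _  = other

-- Every edge v w with w ≠ u becomes the edge u w with the same sign; all
-- other edges are unchanged.  In the clauses with _<∣>_ at most one side
-- is an edge when uv is an edge that lies in no triangle.  The graph is
-- defined for all u and v, but it is the α-transform only under the
-- hypotheses on uv.

module AlphaTransform {n} (Γ : SignedGraph n) (u v : Fin n) where
  open SignedGraph Γ

  label′ : Role → Role → Fin n → Fin n → Maybe Sign
  label′ is-u  is-u  x y = nothing
  label′ is-u  is-v  x y = label u v
  label′ is-u  other x y = label u y <∣> label v y
  label′ is-v  is-u  x y = label v u
  label′ is-v  is-v  x y = nothing
  label′ is-v  other x y = nothing
  label′ other is-u  x y = label x u <∣> label x v
  label′ other is-v  x y = nothing
  label′ other other x y = label x y

  sym′ : ∀ r s x y → label′ r s x y ≡ label′ s r y x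
  sym′ is-u  is-u  x y = refl
  sym′ is-u  is-v  x y = label-sym u v
  sym′ is-u  other x y rewrite label-sym u y | label-sym v y = refl
  sym′ is-v  is-u  x y = label-sym v u
  sym′ is-v  is-v  x y = refl
  sym′ is-v  other x y = refl
  sym′ other is-u  x y rewrite label-sym x u | label-sym x v = refl
  sym′ other is-v  x y = refl
  sym′ other other x y = label-sym x y

  irrefl′ : ∀ r x → label′ r r x x ≡ nothing
  irrefl′ is-u  x = refl
  irrefl′ is-v  x = refl
  irrefl′ other x = label-irrefl x

α : ∀ {n} → SignedGraph n → Fin n → Fin n → SignedGraph n
α {n} Γ u v = record
  { label        = λ x y → label′ (role u v x) (role u v y) x y
  ; label-sym    = λ x y → sym′ (role u v x) (role u v y) x y
  ; label-irrefl = λ x → irrefl′ (role u v x) x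
  }
  where open AlphaTransform Γ u v

module Spectral {c ℓ₁ ℓ₂} (ℝ : Reals c ℓ₁ ℓ₂) where
  open Reals ℝ
  open CommutativeRing commutativeRing using (+-rawMonoid)
  open RawMonoidDefs +-rawMonoid using (sum)

  Matrix : ℕ → Set c
  Matrix n = Fin n → Fin n → Carrier

  infixr 7 _·_
  _·_ : ∀ {n} → Matrix n → Vector Carrier n → Vector Carrier n
  (M · x) i = sum (λ j → M i j * x j)

  IsEigenvector : ∀ {n} → Matrix n → Carrier → Vector Carrier n → Set (ℓ₁ ⊔ ℓ₂)
  IsEigenvector M μ x = (∃ λ i → x i # 0#) × (∀ i → (M · x) i ≈ μ * x i)

  IsEigenvalue : ∀ {n} → Matrix n → Carrier → Set (c ⊔ ℓ₁ ⊔ ℓ₂)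
  IsEigenvalue M μ = ∃ (IsEigenvector M μ)

  IsLargestEigenvalue : ∀ {n} → Matrix n → Carrier → Set (c ⊔ ℓ₁ ⊔ ℓ₂)
  IsLargestEigenvalue M μ = IsEigenvalue M μ × (∀ ν → IsEigenvalue M ν → ν ≤ μ)

  fromSign : Sign → Carrier
  fromSign Sign.+ = 1#
  fromSign Sign.- = - 1#

  adjacency : ∀ {n} → SignedGraph n → Matrix n
  adjacency Γ x y = maybe′ fromSign 0# (SignedGraph.label Γ x y)

  -- The index as a relation, since eigenvalues are not computed here: it
  -- determines its second argument up to ≈.
  IsIndex : ∀ {n} → SignedGraph n → Carrier → Set (c ⊔ ℓ₁ ⊔ ℓ₂)
  IsIndex Γ = IsLargestEigenvalue (adjacency Γ)

{-# OPTIONS --safe #-}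

-- Let d = e_u − e_v, let r be row v of A = A(Γ) with its entry at u removed,
-- and let A′ = A(Γ′).  Since uv is in no triangle, A′ = A + d rᵀ + r dᵀ, hence
-- yᵀA′y = yᵀAy + 2 (y_u − y_v)((Ay)_v − σ(uv) y_u).  At y = x the second term
-- is 2 (x_u − x_v)(λ x_v − σ(uv) x_u), and when σ(uv) < 0 and x_u < x_v one
-- takes for y the vector x with x_u and x_v interchanged, which gives
-- 2 (x_v − x_u)(λ x_u + x_v) on top of λ|x|².  The claim is then the Rayleigh
-- bound yᵀA′y ≤ λ′|y|².
--
-- For the Rayleigh bound from the axioms of Reals, let μ be the supremum of
-- the t with t|y|² < yᵀAy for some y; locatedness comes from eliminating
-- variables with the pivots enlarged by ε.  The same elimination shows that
-- μI − A is negative somewhere, singular, or coercive.  The first and the last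
-- contradict the choice of μ, so μ is an eigenvalue, and a vector violating the
-- bound would make it larger than λ′.

module Submission where

open import Defs
open import Algebra.Bundles using (CommutativeRing)
open import Data.Fin.Base using (Fin; zero; suc)
open import Data.Fin.Properties using (_≟_)
open import Data.Integer.Base as ℤ using (ℤ; +_; -[1+_])
open import Data.Maybe using (Maybe; just; nothing; map; _<∣>_; maybe′; Is-just)
open import Data.Maybe.Relation.Unary.Any using (just)
open import Data.Nat.Base as ℕ using (ℕ; zero; suc)
open import Data.Product.Base using (_×_; _,_; ∃; proj₁; proj₂)
open import Data.Sign.Base using (Sign)
open import Data.Sum.Base using (_⊎_; inj₁; inj₂)
open import Data.Unit.Base using (tt)
open import Data.Vec.Functional using (Vector; _∷_)
open import Function.Base using (_∘_; case_of_)
open import Function.Bundles using (module Equivalence)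
open import Level using (Level; Lift; lift; _⊔_)
open import Relation.Binary.Consequences using (dec⇒weaklyDec)
open import Relation.Binary.PropositionalEquality as ≡ using (_≡_; _≢_)
open import Relation.Binary.Structures using (IsStrictPartialOrder)
open import Relation.Nullary using (¬_; yes; no; contradiction)
open import Relation.Unary using (Pred)
import Algebra.Apartness.Properties.HeytingCommutativeRing as HeytingProperties
import Algebra.Definitions.RawMonoid as RawMonoidDefs
import Algebra.Properties.Ring as RingProperties
import Algebra.Properties.Semiring.Mult.TCOptimised as Multiples
import Algebra.Solver.Ring as RingSolver
import Algebra.Solver.Ring.AlmostCommutativeRing as ACR
import Data.Integer.Properties as ℤ
import Data.Nat.Properties as ℕ
import Relation.Binary.Reasoning.Setoid as SetoidReasoning

-- Ring solving over an arbitrary commutative ring, with integer coefficients.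

module IntegerCoefficientSolver {c ℓ : Level} (R : CommutativeRing c ℓ) where
  open CommutativeRing R
  open RingProperties ring
  open Multiples semiring renaming (_×_ to _ˣ_)
  open SetoidReasoning setoid

  -- Integers serve as coefficients because their equality is decidable while that of `Carrier` is
  -- not. The optimised multiple reduces `1 ˣ 1#` to `1#`, so `con (+ 1)` in a solver equation
  -- matches `1#` in a goal definitionally.
  ⟦_⟧ℤ : ℤ → Carrier
  ⟦ + n ⟧ℤ      = n ˣ 1#
  ⟦ -[1+ n ] ⟧ℤ = - (suc n ˣ 1#)

  ⟦-⟧ : ∀ i → ⟦ ℤ.- i ⟧ℤ ≈ - ⟦ i ⟧ℤ
  ⟦-⟧ (+ zero)   = sym -0#≈0#
  ⟦-⟧ (+ suc n)  = refl
  ⟦-⟧ -[1+ n ]   = sym (-‿involutive _)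

  ⟦⊖⟧ : ∀ m n → ⟦ m ℤ.⊖ n ⟧ℤ ≈ m ˣ 1# - n ˣ 1#
  ⟦⊖⟧ m       zero    = sym (trans (+-congˡ -0#≈0#) (+-identityʳ _))
  ⟦⊖⟧ zero    (suc n) = sym (+-identityˡ _)
  ⟦⊖⟧ (suc m) (suc n) = begin
    ⟦ suc m ℤ.⊖ suc n ⟧ℤ                    ≡⟨ ≡.cong ⟦_⟧ℤ (ℤ.[1+m]⊖[1+n]≡m⊖n m n) ⟩
    ⟦ m ℤ.⊖ n ⟧ℤ                            ≈⟨ ⟦⊖⟧ m n ⟩
    m ˣ 1# - n ˣ 1#                         ≈⟨ +-congʳ (+-identityˡ _) ⟨
    (0# + m ˣ 1#) - n ˣ 1#                  ≈⟨ +-congʳ (+-congʳ (-‿inverseʳ 1#)) ⟨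
    ((1# - 1#) + m ˣ 1#) - n ˣ 1#           ≈⟨ +-congʳ (+-assoc _ _ _) ⟩
    (1# + (- 1# + m ˣ 1#)) - n ˣ 1#         ≈⟨ +-congʳ (+-congˡ (+-comm _ _)) ⟩
    (1# + (m ˣ 1# - 1#)) - n ˣ 1#           ≈⟨ +-congʳ (+-assoc _ _ _) ⟨
    ((1# + m ˣ 1#) - 1#) - n ˣ 1#           ≈⟨ +-assoc _ _ _ ⟩
    (1# + m ˣ 1#) + (- 1# - n ˣ 1#)         ≈⟨ +-cong (1+× m 1#) (⁻¹-∙-comm′ n) ⟨
    suc m ˣ 1# - suc n ˣ 1#                 ∎
    where
    ⁻¹-∙-comm′ : ∀ n → - (suc n ˣ 1#) ≈ - 1# - n ˣ 1#
    ⁻¹-∙-comm′ n = trans (-‿cong (1+× n 1#)) (sym (-‿+-comm _ _))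

  ⟦+⟧ : ∀ i j → ⟦ i ℤ.+ j ⟧ℤ ≈ ⟦ i ⟧ℤ + ⟦ j ⟧ℤ
  ⟦+⟧ (+ m)    (+ n)    = ×-homo-+ 1# m n
  ⟦+⟧ (+ m)    -[1+ n ] = ⟦⊖⟧ m (suc n)
  ⟦+⟧ -[1+ m ] (+ n)    = trans (⟦⊖⟧ n (suc m)) (+-comm _ _)
  ⟦+⟧ -[1+ m ] -[1+ n ] = begin
    - (suc (suc (m ℕ.+ n)) ˣ 1#)        ≡⟨ ≡.cong (λ k → - (suc k ˣ 1#)) (ℕ.+-suc m n) ⟨
    - ((suc m ℕ.+ suc n) ˣ 1#)          ≈⟨ -‿cong (×-homo-+ 1# (suc m) (suc n)) ⟩
    - (suc m ˣ 1# + suc n ˣ 1#)         ≈⟨ -‿+-comm _ _ ⟨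
    - (suc m ˣ 1#) - (suc n ˣ 1#)       ∎

  ⟦-◃⟧ : ∀ n → ⟦ Sign.- ℤ.◃ n ⟧ℤ ≈ - (n ˣ 1#)
  ⟦-◃⟧ n = trans (reflexive (≡.cong ⟦_⟧ℤ (ℤ.-◃n≡-n n))) (⟦-⟧ (+ n))

  ⟦*⟧ : ∀ i j → ⟦ i ℤ.* j ⟧ℤ ≈ ⟦ i ⟧ℤ * ⟦ j ⟧ℤ
  ⟦*⟧ (+ m)    (+ n)    = trans (reflexive (≡.cong ⟦_⟧ℤ (ℤ.+◃n≡+n (m ℕ.* n)))) (×1-homo-* m n)
  ⟦*⟧ (+ m)    -[1+ n ] = trans (⟦-◃⟧ (m ℕ.* suc n)) (trans (-‿cong (×1-homo-* m (suc n))) (-‿distribʳ-* _ _))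
  ⟦*⟧ -[1+ m ] (+ n)    = trans (⟦-◃⟧ (suc m ℕ.* n)) (trans (-‿cong (×1-homo-* (suc m) n)) (-‿distribˡ-* _ _))
  ⟦*⟧ -[1+ m ] -[1+ n ] = begin
    (suc m ℕ.* suc n) ˣ 1#              ≈⟨ ×1-homo-* (suc m) (suc n) ⟩
    (suc m ˣ 1#) * (suc n ˣ 1#)         ≈⟨ -‿involutive _ ⟨
    - - ((suc m ˣ 1#) * (suc n ˣ 1#))   ≈⟨ -‿cong (-‿distribʳ-* _ _) ⟩
    - ((suc m ˣ 1#) * - (suc n ˣ 1#))   ≈⟨ -‿distribˡ-* _ _ ⟩
    - (suc m ˣ 1#) * - (suc n ˣ 1#)     ∎

  morphism : ℤ.+-*-rawRing ACR.-Raw-AlmostCommutative⟶ ACR.fromCommutativeRing R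
  morphism = record
    { ⟦_⟧    = ⟦_⟧ℤ
    ; +-homo = ⟦+⟧
    ; *-homo = ⟦*⟧
    ; -‿homo = ⟦-⟧
    ; 0-homo = refl
    ; 1-homo = refl
    }

  coefficient≟ : ∀ i j → Maybe (⟦ i ⟧ℤ ≈ ⟦ j ⟧ℤ)
  coefficient≟ i j = map (reflexive ∘ ≡.cong ⟦_⟧ℤ) (dec⇒weaklyDec ℤ._≟_ i j)

  open RingSolver ℤ.+-*-rawRing (ACR.fromCommutativeRing R) morphism coefficient≟ public
    using (solve; _:=_; _:+_; _:*_; _:-_; :-_; con)

-- Order arithmetic from the constructive axioms.

module OrderProperties {c ℓ₁ ℓ₂ : Level} (ℝ : Reals c ℓ₁ ℓ₂) where
  open Reals ℝ
  open IntegerCoefficientSolver commutativeRing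
  open HeytingProperties heytingCommutativeRing using (1#0)
  open IsStrictPartialOrder isStrictPartialOrder
    using (<-resp-≈) renaming (irrefl to <-irrefl; trans to <-trans)

  <-resp : ∀ {a b a′ b′} → a ≈ a′ → b ≈ b′ → a < b → a′ < b′
  <-resp a≈a′ b≈b′ a<b = proj₂ <-resp-≈ a≈a′ (proj₁ <-resp-≈ b≈b′ a<b)

  0<-resp : ∀ {a b} → a ≈ b → 0# < a → 0# < b
  0<-resp = <-resp refl

  0≤-resp : ∀ {a b} → a ≈ b → 0# ≤ a → 0# ≤ b
  0≤-resp a≈b 0≤a b<0 = 0≤a (<-resp (sym a≈b) refl b<0)

  <⇒0<- : ∀ {a b} → a < b → 0# < b - a
  <⇒0<- {a} {b} a<b = <-resp (-‿inverseˡ a) (+-comm (- a) b) (+-monoʳ-< (- a) a<b)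

  0<-⇒< : ∀ {a b} → 0# < b - a → a < b
  0<-⇒< {a} {b} 0<b-a = <-resp (+-identityʳ a)
    (solve 2 (λ a b → a :+ (b :- a) := b) refl a b) (+-monoʳ-< a 0<b-a)

  ≤⇒0≤- : ∀ {a b} → a ≤ b → 0# ≤ b - a
  ≤⇒0≤- {a} {b} a≤b b-a<0 = a≤b (0<-⇒< (<-resp refl
    (solve 2 (λ a b → con (+ 0) :- (b :- a) := a :- b) refl a b) (<⇒0<- b-a<0)))

  0≤-⇒≤ : ∀ {a b} → 0# ≤ b - a → a ≤ b
  0≤-⇒≤ {a} {b} 0≤b-a b<a = 0≤b-a (0<-⇒< (<-resp refl
    (solve 2 (λ a b → a :- b := con (+ 0) :- (b :- a)) refl a b) (<⇒0<- b<a)))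

  <0⇒0<- : ∀ {a} → a < 0# → 0# < - a
  <0⇒0<- a<0 = 0<-resp (+-identityˡ _) (<⇒0<- a<0)

  0<-⇒<0 : ∀ {a} → 0# < - a → a < 0#
  0<-⇒<0 0<-a = 0<-⇒< (0<-resp (sym (+-identityˡ _)) 0<-a)

  <⇒≤ : ∀ {a b} → a < b → a ≤ b
  <⇒≤ a<b b<a = <-irrefl refl (<-trans a<b b<a)

  ≈⇒0≤ : ∀ {a} → 0# ≈ a → 0# ≤ a
  ≈⇒0≤ 0≈a a<0 = <-irrefl (sym 0≈a) a<0

  <⇒# : ∀ {a b} → a < b → a # b
  <⇒# a<b = Equivalence.from #⇔<⊎> (inj₁ a<b)

  #⇒<⊎> : ∀ {a b} → a # b → a < b ⊎ b < a
  #⇒<⊎> = Equivalence.to #⇔<⊎>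

  -- Apartness is cotransitive, and each apartness found has an orientation; an orientation in the
  -- unwanted direction yields the other alternative by transitivity. This replaces deciding the
  -- order of two elements.
  <-cotrans : ∀ {a b} → a < b → ∀ z → a < z ⊎ z < b
  <-cotrans a<b z with #-cotrans (<⇒# a<b) z
  ... | inj₁ a#z with #⇒<⊎> a#z
  ...   | inj₁ a<z = inj₁ a<z
  ...   | inj₂ z<a = inj₂ (<-trans z<a a<b)
  <-cotrans a<b z | inj₂ z#b with #⇒<⊎> z#b
  ...   | inj₁ z<b = inj₂ z<b
  ...   | inj₂ b<z = inj₁ (<-trans a<b b<z)

  <-≤-trans : ∀ {a b d} → a < b → b ≤ d → a < d
  <-≤-trans {d = d} a<b b≤d with <-cotrans a<b d
  ... | inj₁ a<d = a<d
  ... | inj₂ d<b = contradiction d<b b≤d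

  ≤-<-trans : ∀ {a b d} → a ≤ b → b < d → a < d
  ≤-<-trans {a} a≤b b<d with <-cotrans b<d a
  ... | inj₁ b<a = contradiction b<a a≤b
  ... | inj₂ a<d = a<d

  -- Refuting both strict cases refutes `a # 0#`, and tightness then gives `a ≈ 0#`. So a sign may
  -- be split whenever the goal is a negation, which covers every goal of the form `_≤_`.
  trichotomous : ∀ {p} {P : Set p} a → (a < 0# → ¬ P) → (a ≈ 0# → ¬ P) → (0# < a → ¬ P) → ¬ P
  trichotomous a neg zer pos p =
    zer (proj₁ (tight a 0#) λ a#0 → case (#⇒<⊎> a#0)) p
    where
    case : ¬ (a < 0# ⊎ 0# < a)
    case (inj₁ a<0) = neg a<0 p
    case (inj₂ 0<a) = pos 0<a p

  0<+ : ∀ {a b} → 0# < a → 0# ≤ b → 0# < a + b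
  0<+ {a} {b} 0<a 0≤b = 0<-resp (+-comm b a)
    (≤-<-trans 0≤b (<-resp (+-identityʳ b) refl (+-monoʳ-< b 0<a)))

  0≤+ : ∀ {a b} → 0# ≤ a → 0# ≤ b → 0# ≤ a + b
  0≤+ {a} {b} 0≤a 0≤b a+b<0 = 0≤a (0<-⇒<0 (0<-resp
    (solve 2 (λ a b → :- (a :+ b) :+ b := :- a) refl a b)
    (0<+ (<0⇒0<- a+b<0) 0≤b)))

  0≤* : ∀ {a b} → 0# ≤ a → 0# ≤ b → 0# ≤ a * b
  0≤* {a} {b} 0≤a 0≤b ab<0 = trichotomous a (λ a<0 → contradiction a<0 0≤a)
    (λ a≈0 → ≈⇒0≤ (sym (trans (*-congʳ a≈0) (zeroˡ b))))
    (λ 0<a ab<0 → trichotomous b (λ b<0 → contradiction b<0 0≤b)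
      (λ b≈0 → ≈⇒0≤ (sym (trans (*-congˡ b≈0) (zeroʳ a))))
      (λ 0<b → <⇒≤ (*-pos 0<a 0<b)) ab<0)
    ab<0

  0≤sq : ∀ a → 0# ≤ a * a
  0≤sq a = trichotomous a
    (λ a<0 → <⇒≤ (0<-resp (solve 1 (λ a → :- a :* :- a := a :* a) refl a)
      (*-pos (<0⇒0<- a<0) (<0⇒0<- a<0))))
    (λ a≈0 → ≈⇒0≤ (sym (trans (*-congʳ a≈0) (zeroˡ a))))
    (λ 0<a → <⇒≤ (*-pos 0<a 0<a))

  #0⇒0<sq : ∀ {a} → a # 0# → 0# < a * a
  #0⇒0<sq {a} a#0 with #⇒<⊎> a#0
  ... | inj₁ a<0 = 0<-resp (solve 1 (λ a → :- a :* :- a := a :* a) refl a)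
                     (*-pos (<0⇒0<- a<0) (<0⇒0<- a<0))
  ... | inj₂ 0<a = *-pos 0<a 0<a

  0<1 : 0# < 1#
  0<1 = 0<-resp (*-identityˡ 1#) (#0⇒0<sq 1#0)

  #0⇒inverse : ∀ {a} → a # 0# → ∃ λ w → a * w ≈ 1#
  #0⇒inverse {a} a#0 with #⇒invertible a#0
  ... | w , _ , [a-0]w≈1 = w , trans (solve 2 (λ a w → a :* w := (a :- con (+ 0)) :* w) refl a w) [a-0]w≈1

  0<⇒inverse : ∀ {a} → 0# < a → ∃ λ w → 0# < w × a * w ≈ 1#
  0<⇒inverse {a} 0<a with #0⇒inverse (#-sym (<⇒# 0<a))
  ... | w , aw≈1 = w , 0<w , aw≈1
    where
    -- w = a w²
    0<w : 0# < w
    0<w = 0<-resp (trans (solve 2 (λ a w → a :* (w :* w) := a :* w :* w) refl a w)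
                         (trans (*-congʳ aw≈1) (*-identityˡ w)))
                  (*-pos 0<a (#0⇒0<sq w#0))
      where
      w#0 : w # 0#
      w#0 = invertible⇒# (a , trans (solve 2 (λ a w → a :* (w :- con (+ 0)) := a :* w) refl a w) aw≈1
                            , trans (solve 2 (λ a w → (w :- con (+ 0)) :* a := a :* w) refl a w) aw≈1)

  *-cancelʳ-0< : ∀ {a b} → 0# < b → 0# < a * b → 0# < a
  *-cancelʳ-0< {a} {b} 0<b 0<ab with 0<⇒inverse 0<b
  ... | w , 0<w , bw≈1 = 0<-resp (trans (*-assoc a b w) (trans (*-congˡ bw≈1) (*-identityʳ a)))
                                 (*-pos 0<ab 0<w)

  #0⇒double#0 : ∀ {a} → a # 0# → a + a # 0#
  #0⇒double#0 {a} a#0 with #⇒<⊎> a#0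
  ... | inj₂ 0<a = #-sym (<⇒# (0<+ 0<a (<⇒≤ 0<a)))
  ... | inj₁ a<0 = <⇒# (0<-⇒<0 (0<-resp (solve 1 (λ a → :- a :+ :- a := :- (a :+ a)) refl a)
                     (0<+ (<0⇒0<- a<0) (<⇒≤ (<0⇒0<- a<0)))))

-- Dot products and quadratic forms.

module QuadraticForms {c ℓ₁ ℓ₂ : Level} (ℝ : Reals c ℓ₁ ℓ₂) where
  open Reals ℝ hiding (zero)
  open Spectral ℝ
  open IntegerCoefficientSolver commutativeRing
  open OrderProperties ℝ
  open CommutativeRing commutativeRing using (+-rawMonoid)
  open RawMonoidDefs +-rawMonoid using (sum)
  open SetoidReasoning setoid

  private variable
    n : ℕ

  -- Schur complements, shifts, the rank-two update and the swapped vector are all written with this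
  -- one combination, so `dot-combʳ` and `dot-combˡ` supply their linearity.
  comb : Carrier → Vector Carrier n → Carrier → Vector Carrier n → Vector Carrier n
  comb k a l b i = k * a i + l * b i

  dot : Vector Carrier n → Vector Carrier n → Carrier
  dot x y = sum λ i → x i * y i

  normSq : Vector Carrier n → Carrier
  normSq x = dot x x

  form : Matrix n → Vector Carrier n → Carrier
  form M x = dot x (M · x)

  Symmetric : Matrix n → Set _
  Symmetric M = ∀ i j → M i j ≈ M j i

  dot-cong : {a b x y : Vector Carrier n} → (∀ i → a i ≈ b i) → (∀ i → x i ≈ y i) → dot a x ≈ dot b y
  dot-cong {zero}  a≈b x≈y = refl
  dot-cong {suc n} a≈b x≈y = +-cong (*-cong (a≈b zero) (x≈y zero)) (dot-cong (a≈b ∘ suc) (x≈y ∘ suc))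

  dot-comm : (x y : Vector Carrier n) → dot x y ≈ dot y x
  dot-comm {zero}  x y = refl
  dot-comm {suc n} x y = +-cong (*-comm _ _) (dot-comm (x ∘ suc) (y ∘ suc))

  dot-combʳ : (x : Vector Carrier n) → ∀ k a l b → dot x (comb k a l b) ≈ k * dot x a + l * dot x b
  dot-combʳ {zero}  x k a l b = solve 2 (λ k l → con (+ 0) := k :* con (+ 0) :+ l :* con (+ 0)) refl k l
  dot-combʳ {suc n} x k a l b = trans (+-congˡ (dot-combʳ (x ∘ suc) k (a ∘ suc) l (b ∘ suc)))
    (solve 7 (λ x k a l b α β → x :* (k :* a :+ l :* b) :+ (k :* α :+ l :* β)
                             := k :* (x :* a :+ α) :+ l :* (x :* b :+ β)) refl
      (x zero) k (a zero) l (b zero) (dot (x ∘ suc) (a ∘ suc)) (dot (x ∘ suc) (b ∘ suc)))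

  dot-combˡ : ∀ k (a : Vector Carrier n) l b x → dot (comb k a l b) x ≈ k * dot a x + l * dot b x
  dot-combˡ k a l b x = trans (dot-comm _ x) (trans (dot-combʳ x k a l b)
    (+-cong (*-congˡ (dot-comm x a)) (*-congˡ (dot-comm x b))))

  0≤normSq : (x : Vector Carrier n) → 0# ≤ normSq x
  0≤normSq {zero}  x = ≈⇒0≤ refl
  0≤normSq {suc n} x = 0≤+ (0≤sq (x zero)) (0≤normSq (x ∘ suc))

  0<normSq : (x : Vector Carrier n) → (∃ λ i → x i # 0#) → 0# < normSq x
  0<normSq x (zero  , xᵢ#0) = 0<+ (#0⇒0<sq xᵢ#0) (0≤normSq (x ∘ suc))
  0<normSq x (suc i , xᵢ#0) = 0<-resp (+-comm _ _) (0<+ (0<normSq (x ∘ suc) (i , xᵢ#0)) (0≤sq (x zero)))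

  basis : Fin n → Vector Carrier n
  basis zero    = 1# ∷ λ _ → 0#
  basis (suc i) = 0# ∷ basis i

  basis-diag : (i : Fin n) → basis i i ≈ 1#
  basis-diag zero    = refl
  basis-diag (suc i) = basis-diag i

  basis-off : {i j : Fin n} → i ≢ j → basis i j ≈ 0#
  basis-off {i = zero}  {zero}  i≢j = contradiction ≡.refl i≢j
  basis-off {i = zero}  {suc j} i≢j = refl
  basis-off {i = suc i} {zero}  i≢j = refl
  basis-off {i = suc i} {suc j} i≢j = basis-off (i≢j ∘ ≡.cong suc)

  dot-zeroˡ : (x : Vector Carrier n) → dot (λ _ → 0#) x ≈ 0#
  dot-zeroˡ {zero}  x = refl
  dot-zeroˡ {suc n} x = trans (+-cong (zeroˡ _) (dot-zeroˡ (x ∘ suc))) (+-identityˡ 0#)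

  dot-basisˡ : ∀ i (x : Vector Carrier n) → dot (basis i) x ≈ x i
  dot-basisˡ zero    x = trans (+-cong (*-identityˡ _) (dot-zeroˡ (x ∘ suc))) (+-identityʳ _)
  dot-basisˡ (suc i) x = trans (+-cong (zeroˡ _) (dot-basisˡ i (x ∘ suc))) (+-identityˡ _)

  dot-basisʳ : ∀ (x : Vector Carrier n) i → dot x (basis i) ≈ x i
  dot-basisʳ x i = trans (dot-comm x (basis i)) (dot-basisˡ i x)

  form-basis : ∀ (M : Matrix n) i → form M (basis i) ≈ M i i
  form-basis M i = trans (dot-basisˡ i (M · basis i)) (dot-basisʳ (M i) i)

  -- Elimination of the first variable of a symmetric form.

  module Elimination (M : Matrix (suc n)) (M-sym : Symmetric M) where
    pivot : Carrier
    pivot = M zero zero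

    row : Vector Carrier n
    row = M zero ∘ suc

    minor : Matrix n
    minor i j = M (suc i) (suc j)

    minor-sym : Symmetric minor
    minor-sym i j = M-sym (suc i) (suc j)

    bilinear-split : ∀ x y → dot x (M · y) ≈
      pivot * (x zero * y zero) + (x zero * dot row (y ∘ suc) + y zero * dot row (x ∘ suc))
        + dot (x ∘ suc) (minor · (y ∘ suc))
    bilinear-split x y = begin
      x zero * (pivot * y zero + dot row y⁺) + dot x⁺ (λ i → M (suc i) zero * y zero + (minor · y⁺) i)
        ≈⟨ +-congˡ (dot-cong {b = x⁺} (λ _ → refl) λ i →
             +-cong (trans (*-congʳ (M-sym (suc i) zero)) (*-comm _ _)) (sym (*-identityˡ _))) ⟩
      x zero * (pivot * y zero + dot row y⁺) + dot x⁺ (comb (y zero) row 1# (minor · y⁺))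
        ≈⟨ +-congˡ (dot-combʳ x⁺ (y zero) row 1# (minor · y⁺)) ⟩
      x zero * (pivot * y zero + dot row y⁺) + (y zero * dot x⁺ row + 1# * dot x⁺ (minor · y⁺))
        ≈⟨ +-congˡ (+-congʳ (*-congˡ (dot-comm x⁺ row))) ⟩
      x zero * (pivot * y zero + dot row y⁺) + (y zero * dot row x⁺ + 1# * dot x⁺ (minor · y⁺))
        ≈⟨ solve 6 (λ x y m ry rx q → x :* (m :* y :+ ry) :+ (y :* rx :+ con (+ 1) :* q)
                                 := m :* (x :* y) :+ (x :* ry :+ y :* rx) :+ q) refl
             (x zero) (y zero) pivot (dot row y⁺) (dot row x⁺) (dot x⁺ (minor · y⁺)) ⟩
      pivot * (x zero * y zero) + (x zero * dot row y⁺ + y zero * dot row x⁺) + dot x⁺ (minor · y⁺) ∎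
      where
      x⁺ = x ∘ suc
      y⁺ = y ∘ suc

    form-split : ∀ x → let t = x zero; z = x ∘ suc in
                 form M x ≈ pivot * (t * t) + (t * dot row z + t * dot row z) + form minor z
    form-split x = bilinear-split x x

    -- This is `minor - w row rowᵀ`, the Schur complement when `w` inverts the pivot. The parameter
    -- `w` is free so that the pivot can first be enlarged.
    schur : Carrier → Matrix n
    schur w i = comb 1# (minor i) (- (w * row i)) row

    schur-sym : ∀ w → Symmetric (schur w)
    schur-sym w i j = +-cong (*-congˡ (minor-sym i j))
      (solve 3 (λ w a b → :- (w :* a) :* b := :- (w :* b) :* a) refl w (row i) (row j))

    schur-· : ∀ w z i → (schur w · z) i ≈ (minor · z) i - w * row i * dot row z
    schur-· w z i = trans (dot-combˡ 1# (minor i) (- (w * row i)) row z)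
      (solve 4 (λ a w r s → con (+ 1) :* a :+ :- (w :* r) :* s := a :- w :* r :* s) refl
        ((minor · z) i) w (row i) (dot row z))

    form-schur : ∀ w z → form (schur w) z ≈ form minor z - w * (dot row z * dot row z)
    form-schur w z = begin
      dot z (schur w · z)
        ≈⟨ dot-cong {b = z} (λ _ → refl) (λ i → trans (schur-· w z i)
             (solve 4 (λ a w r s → a :- w :* r :* s := con (+ 1) :* a :+ :- (w :* s) :* r) refl
               ((minor · z) i) w (row i) (dot row z))) ⟩
      dot z (comb 1# (minor · z) (- (w * dot row z)) row)
        ≈⟨ dot-combʳ z 1# (minor · z) (- (w * dot row z)) row ⟩
      1# * form minor z + - (w * dot row z) * dot z row
        ≈⟨ +-congˡ (*-congˡ (dot-comm z row)) ⟩
      1# * form minor z + - (w * dot row z) * dot row z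
        ≈⟨ solve 3 (λ q w s → con (+ 1) :* q :+ :- (w :* s) :* s := q :- w :* (s :* s)) refl
             (form minor z) w (dot row z) ⟩
      form minor z - w * (dot row z * dot row z) ∎

    -- Since `p w = 1`, the square `p (t + w s)²` equals `p t² + 2 t s + w s²`. The Schur complement
    -- absorbs `w s²`, and the last term corrects for using `p` in place of the pivot. It is applied
    -- with `p = pivot + ε` and with `p = pivot`.
    complete-square : ∀ {p w} → p * w ≈ 1# → ∀ x → let t = x zero; z = x ∘ suc; r = t + w * dot row z in
      form M x ≈ p * (r * r) + form (schur w) z - (p - pivot) * (t * t)
    complete-square {p} {w} pw≈1 x = begin
      form M x
        ≈⟨ form-split x ⟩
      pivot * (t * t) + (t * s + t * s) + q
        -- The spare factors `1#` mark where `p * w` is substituted next, because the solver cannot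
        -- use `pw≈1`.
        ≈⟨ solve 5 (λ t m s q p →
             m :* (t :* t) :+ (t :* s :+ t :* s) :+ q
             := p :* (t :* t) :+ (t :* s :* con (+ 1) :+ t :* s :* con (+ 1)) :+ q
                :- (p :- m) :* (t :* t)) refl t pivot s q p ⟩
      p * (t * t) + (t * s * 1# + t * s * 1#) + q - (p - pivot) * (t * t)
        ≈⟨ +-congʳ (+-congʳ (+-congˡ (+-cong (*-congˡ pw≈1) (*-congˡ pw≈1)))) ⟨
      p * (t * t) + (t * s * (p * w) + t * s * (p * w)) + q - (p - pivot) * (t * t)
        ≈⟨ solve 6 (λ t m s q p w →
             p :* (t :* t) :+ (t :* s :* (p :* w) :+ t :* s :* (p :* w)) :+ q
                :- (p :- m) :* (t :* t)
             := p :* ((t :+ w :* s) :* (t :+ w :* s)) :+ (q :- (p :* w) :* (w :* (s :* s)))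
                :- (p :- m) :* (t :* t)) refl t pivot s q p w ⟩
      p * ((t + w * s) * (t + w * s)) + (q - (p * w) * (w * (s * s))) - (p - pivot) * (t * t)
        ≈⟨ +-congʳ (+-congˡ (+-congˡ (-‿cong (trans (*-congʳ pw≈1) (*-identityˡ _))))) ⟩
      p * ((t + w * s) * (t + w * s)) + (q - w * (s * s)) - (p - pivot) * (t * t)
        ≈⟨ +-congʳ (+-congˡ (form-schur w z)) ⟨
      p * ((t + w * s) * (t + w * s)) + form (schur w) z - (p - pivot) * (t * t) ∎
      where
      t = x zero
      z = x ∘ suc
      s = dot row z
      q = form minor z

  -- The expansion along the first variable is visibly symmetric in `x` and `y` apart from the
  -- minor, so induction replaces an exchange of double sums.
  dot-symmetric : (M : Matrix n) → Symmetric M → ∀ x y → dot x (M · y) ≈ dot y (M · x)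
  dot-symmetric {zero}  M M-sym x y = refl
  dot-symmetric {suc n} M M-sym x y = begin
    dot x (M · y)
      ≈⟨ bilinear-split x y ⟩
    pivot * (x zero * y zero) + (x zero * dot row y⁺ + y zero * dot row x⁺) + dot x⁺ (minor · y⁺)
      ≈⟨ +-cong (+-cong (*-congˡ (*-comm _ _)) (+-comm _ _)) (dot-symmetric minor minor-sym x⁺ y⁺) ⟩
    pivot * (y zero * x zero) + (y zero * dot row x⁺ + x zero * dot row y⁺) + dot y⁺ (minor · x⁺)
      ≈⟨ bilinear-split y x ⟨
    dot y (M · x) ∎
    where
    open Elimination M M-sym
    x⁺ = x ∘ suc
    y⁺ = y ∘ suc

-- Definiteness of symmetric matrices by elimination.

module Definiteness {c ℓ₁ ℓ₂ : Level} (ℝ : Reals c ℓ₁ ℓ₂) where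
  open Reals ℝ hiding (zero)
  open Spectral ℝ
  open IntegerCoefficientSolver commutativeRing
  open OrderProperties ℝ
  open QuadraticForms ℝ
  open SetoidReasoning setoid

  private variable
    n : ℕ

  -- The sign of the pivot is not decidable, but comparing `0#` with `pivot < pivot + ε` gives
  -- either a negative diagonal entry or a positive `p = pivot + ε` to divide by. Using `p` costs
  -- `ε t²`, which is exactly the share of the eliminated variable in `ε * normSq x`.
  negative-or-almost-nonnegative : (M : Matrix n) → Symmetric M → ∀ {ε} → 0# < ε →
    (∃ λ x → form M x < 0#) ⊎ (∀ x → 0# ≤ form M x + ε * normSq x)
  negative-or-almost-nonnegative {zero} M M-sym {ε} 0<ε =
    inj₂ λ _ → ≈⇒0≤ (solve 1 (λ ε → con (+ 0) := con (+ 0) :+ ε :* con (+ 0)) refl ε)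
  negative-or-almost-nonnegative {suc n} M M-sym {ε} 0<ε =
    case <-cotrans m<m+ε 0# of λ where
      (inj₁ m<0)   → inj₁ (basis zero , <-resp (sym (form-basis M zero)) refl m<0)
      (inj₂ 0<m+ε) → eliminate 0<m+ε
    where
    open Elimination M M-sym
    m<m+ε : pivot < pivot + ε
    m<m+ε = <-resp (+-identityʳ pivot) refl (+-monoʳ-< pivot 0<ε)
    eliminate : 0# < pivot + ε → (∃ λ x → form M x < 0#) ⊎ (∀ x → 0# ≤ form M x + ε * normSq x)
    eliminate 0<p = case negative-or-almost-nonnegative (schur w) (schur-sym w) 0<ε of λ where
        -- This first coordinate makes the square vanish, leaving the negative Schur value minus `ε`
        -- times a square.
        (inj₁ (z , q<0)) → inj₁ (- (w * dot row z) ∷ z , 0<-⇒<0 (0<-resp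
          (trans (solve 6 (λ q ε a m p ws →
               :- q :+ ε :* (a :* a)
               := :- (p :* ((:- ws :+ ws) :* (:- ws :+ ws)) :+ q :- ε :* (a :* a)))
               refl (form (schur w) z) ε (- (w * dot row z)) pivot p (w * dot row z))
            (-‿cong (sym (square (- (w * dot row z) ∷ z)))))
          (0<+ (<0⇒0<- q<0) (0≤* (<⇒≤ 0<ε) (0≤sq _)))))
        (inj₂ 0≤q) → inj₂ λ x → let t = x zero; z = x ∘ suc; r = t + w * dot row z in
          0≤-resp (trans (solve 6 (λ p r q ε t N →
                     p :* (r :* r) :+ (q :+ ε :* N)
                     := p :* (r :* r) :+ q :- ε :* (t :* t) :+ ε :* (t :* t :+ N))
                     refl p r (form (schur w) z) ε t (normSq z))
                   (+-congʳ (sym (square x))))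
            (0≤+ (0≤* (<⇒≤ 0<p) (0≤sq r)) (0≤q z))
      where
      p = pivot + ε
      w = proj₁ (0<⇒inverse 0<p)
      pw≈1 = proj₂ (proj₂ (0<⇒inverse 0<p))
      square : ∀ x → let t = x zero; z = x ∘ suc; r = t + w * dot row z in
        form M x ≈ p * (r * r) + form (schur w) z - ε * (t * t)
      square x = trans (complete-square pw≈1 x)
        (+-congˡ (-‿cong (*-congʳ (solve 2 (λ m ε → m :+ ε :- m := ε) refl pivot ε))))

  -- A crude Cauchy-Schwarz inequality: `(b t + s)² ≤ 2 b² t² + 2 s²` is applied one coordinate at a
  -- time, so the constant is doubled at each step.
  dot-bounded : (b : Vector Carrier n) →
    ∃ λ C → 0# ≤ C × ∀ z → 0# ≤ C * normSq z - dot b z * dot b z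
  dot-bounded {zero}  b = 0# , ≈⇒0≤ refl ,
    λ _ → ≈⇒0≤ (solve 0 (con (+ 0) := con (+ 0) :* con (+ 0) :- con (+ 0) :* con (+ 0)) refl)
  dot-bounded {suc n} b with dot-bounded (b ∘ suc)
  ... | C , 0≤C , bound = (bb + bb) + (C + C) , 0≤+ (0≤+ 0≤bb 0≤bb) (0≤+ 0≤C 0≤C) , λ z →
        let t = z zero; N = normSq (z ∘ suc); s = dot (b ∘ suc) (z ∘ suc); h = bound (z ∘ suc) in
        0≤-resp (solve 5 (λ b t s C N →
            (b :* t :- s) :* (b :* t :- s) :+ ((C :* N :- s :* s) :+ (C :* N :- s :* s))
              :+ ((C :+ C) :* (t :* t) :+ (b :* b :+ b :* b) :* N)
            := ((b :* b :+ b :* b) :+ (C :+ C)) :* (t :* t :+ N)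
              :- (b :* t :+ s) :* (b :* t :+ s)) refl (b zero) t s C N)
          (0≤+ (0≤+ (0≤sq (b zero * t - s)) (0≤+ h h))
            (0≤+ (0≤* (0≤+ 0≤C 0≤C) (0≤sq t)) (0≤* (0≤+ 0≤bb 0≤bb) (0≤normSq (z ∘ suc)))))
    where
    bb = b zero * b zero
    0≤bb = 0≤sq (b zero)

  -- The maximum of `0#` and `a` cannot be found by cases on the sign of `a`; locating `a` relative
  -- to the gap from `0#` to `1#` gives `a` or `1#` as a bound.
  nonnegative-bound : ∀ a → ∃ λ b → 0# ≤ b × a ≤ b
  nonnegative-bound a with <-cotrans 0<1 a
  ... | inj₁ 0<a = a , <⇒≤ 0<a , ≤-refl
    where
    ≤-refl : a ≤ a
    ≤-refl = 0≤-⇒≤ (≈⇒0≤ (sym (-‿inverseʳ a)))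
  ... | inj₂ a<1 = 1# , <⇒≤ 0<1 , <⇒≤ a<1

  -- The mixed term satisfies `2 t s ≤ t² + s²`, and `s²` is controlled by `dot-bounded`. The
  -- constant makes the set of values below Rayleigh quotients bounded above.
  form-bounded : (M : Matrix n) → Symmetric M →
    ∃ λ K → 0# ≤ K × ∀ x → 0# ≤ K * normSq x - form M x
  form-bounded {zero}  M M-sym = 0# , ≈⇒0≤ refl ,
    λ _ → ≈⇒0≤ (solve 0 (con (+ 0) := con (+ 0) :* con (+ 0) :- con (+ 0)) refl)
  form-bounded {suc n} M M-sym
    with nonnegative-bound (M zero zero) | dot-bounded (M zero ∘ suc)
       | form-bounded (Elimination.minor M M-sym) (Elimination.minor-sym M M-sym)
  ... | P , 0≤P , m≤P | C , 0≤C , s²≤ | K , 0≤K , q≤ =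
      P + 1# + C + K , 0≤+ (0≤+ (0≤+ 0≤P (<⇒≤ 0<1)) 0≤C) 0≤K , λ x →
      let t = x zero; z = x ∘ suc; s = dot row z; q = form minor z; N = normSq z in
      0≤-resp (trans
          (solve 8 (λ P C K t s q N m →
            (P :- m) :* (t :* t) :+ (t :- s) :* (t :- s)
              :+ ((C :* N :- s :* s) :+ (K :* N :- q))
              :+ ((C :+ K) :* (t :* t) :+ (P :+ con (+ 1)) :* N)
            := (P :+ con (+ 1) :+ C :+ K) :* (t :* t :+ N)
              :- (m :* (t :* t) :+ (t :* s :+ t :* s) :+ q)) refl P C K t s q N pivot)
          (+-congˡ (-‿cong (sym (form-split x)))))
        (0≤+ (0≤+ (0≤+ (0≤* (≤⇒0≤- m≤P) (0≤sq t)) (0≤sq (t - s))) (0≤+ (s²≤ z) (q≤ z)))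
          (0≤+ (0≤* (0≤+ 0≤C 0≤K) (0≤sq t)) (0≤* (0≤+ 0≤P (<⇒≤ 0<1)) (0≤normSq z))))
    where open Elimination M M-sym

  Negative : Matrix n → Set _
  Negative M = ∃ λ x → form M x < 0#

  Singular : Matrix n → Set _
  Singular M = ∃ λ x → (∃ λ i → x i # 0#) × (∀ i → (M · x) i ≈ 0#)

  -- Positive definiteness with a uniform margin. The constant `K` measures how far the shift `μ`
  -- can be lowered while the form stays nonnegative.
  Coercive : Matrix n → Set _
  Coercive M = ∃ λ K → 0# ≤ K × ∀ x → 0# ≤ form M x × 0# ≤ K * form M x - normSq x

  ¬¬-zero-or-apart : (b : Vector Carrier n) → ¬ ¬ ((∀ i → b i ≈ 0#) ⊎ ∃ λ i → b i # 0#)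
  ¬¬-zero-or-apart b neither =
    neither (inj₁ λ i → proj₁ (tight _ _) λ bᵢ#0 → neither (inj₂ (i , bᵢ#0)))

  -- Exact elimination needs the sign of the pivot, hence the double negation. A negative pivot is a
  -- negative value, and a positive one reduces to the Schur complement. At a zero pivot, either the
  -- whole first row vanishes and the first basis vector is in the kernel, or an entry apart from
  -- zero makes the form indefinite.
  definiteness-trichotomy : (M : Matrix n) → Symmetric M → ¬ ¬ (Negative M ⊎ Singular M ⊎ Coercive M)
  definiteness-trichotomy {zero} M M-sym k = k (inj₂ (inj₂ (0# , ≈⇒0≤ refl , λ _ → ≈⇒0≤ refl ,
    ≈⇒0≤ (solve 0 (con (+ 0) := con (+ 0) :* con (+ 0) :- con (+ 0)) refl))))
  definiteness-trichotomy {suc n} M M-sym = trichotomous pivot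
    (λ m<0 k → k (inj₁ (basis zero , <-resp (sym (form-basis M zero)) refl m<0)))
    (λ m≈0 k → ¬¬-zero-or-apart row λ where
      (inj₁ row≈0)       → k (inj₂ (inj₁ (singular m≈0 row≈0)))
      (inj₂ (j , rⱼ#0)) → k (inj₁ (negative m≈0 j rⱼ#0)))
    (λ 0<m k → definiteness-trichotomy (schur (w 0<m)) (schur-sym (w 0<m)) λ where
      (inj₁ (z , q<0))              → k (inj₁ (lift-negative 0<m z q<0))
      (inj₂ (inj₁ (z , z#0 , Sz≈0))) → k (inj₂ (inj₁ (lift-singular 0<m z z#0 Sz≈0)))
      (inj₂ (inj₂ coercive))        → k (inj₂ (inj₂ (lift-coercive 0<m coercive))))
    where
    open Elimination M M-sym

    w : 0# < pivot → Carrier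
    w 0<m = proj₁ (0<⇒inverse 0<m)

    singular : pivot ≈ 0# → (∀ j → row j ≈ 0#) → Singular M
    singular m≈0 row≈0 = basis zero , (zero , #-sym (<⇒# 0<1)) , λ where
      zero    → trans (dot-basisʳ (M zero) zero) m≈0
      (suc i) → trans (dot-basisʳ (M (suc i)) zero) (trans (M-sym (suc i) zero) (row≈0 i))

    -- On (t, eⱼ) the form is 2 t rⱼ + κ, and t is chosen to make it -1.
    negative : pivot ≈ 0# → ∀ j → row j # 0# → Negative M
    negative m≈0 j rⱼ#0 with #0⇒inverse (#0⇒double#0 rⱼ#0)
    ... | w , 2rw≈1 = t ∷ basis j , <-resp (sym form≈-1) refl
          (0<-⇒<0 (0<-resp (solve 0 (con (+ 1) := :- :- con (+ 1)) refl) 0<1))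
      where
      κ = form minor (basis j)
      r = row j
      t = - (w * (κ + 1#))
      tr≈ : t * dot row (basis j) ≈ t * r
      tr≈ = *-congˡ (dot-basisʳ row j)
      form≈-1 : form M (t ∷ basis j) ≈ - 1#
      form≈-1 = begin
        form M (t ∷ basis j)
          ≈⟨ form-split (t ∷ basis j) ⟩
        pivot * (t * t) + (t * dot row (basis j) + t * dot row (basis j)) + κ
          ≈⟨ +-congʳ (+-cong (*-congʳ m≈0) (+-cong tr≈ tr≈)) ⟩
        0# * (t * t) + (t * r + t * r) + κ
          ≈⟨ solve 3 (λ w κ r → con (+ 0) :* (:- (w :* (κ :+ con (+ 1))) :* :- (w :* (κ :+ con (+ 1))))
                 :+ (:- (w :* (κ :+ con (+ 1))) :* r :+ :- (w :* (κ :+ con (+ 1))) :* r) :+ κ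
               := :- (((r :+ r) :* w) :* (κ :+ con (+ 1))) :+ κ) refl w κ r ⟩
        - (((r + r) * w) * (κ + 1#)) + κ
          ≈⟨ +-congʳ (-‿cong (*-congʳ 2rw≈1)) ⟩
        - (1# * (κ + 1#)) + κ
          ≈⟨ solve 1 (λ κ → :- (con (+ 1) :* (κ :+ con (+ 1))) :+ κ := :- con (+ 1)) refl κ ⟩
        - 1# ∎

    module _ (0<m : 0# < pivot) where
      private
        v = w 0<m
        mv≈1 = proj₂ (proj₂ (0<⇒inverse 0<m))
        0<v = proj₁ (proj₂ (0<⇒inverse 0<m))

        square : ∀ x → let r = x zero + v * dot row (x ∘ suc) in
          form M x ≈ pivot * (r * r) + form (schur v) (x ∘ suc)
        square x = trans (complete-square mv≈1 x)
          (solve 4 (λ m r q t → m :* (r :* r) :+ q :- (m :- m) :* (t :* t) := m :* (r :* r) :+ q) refl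
            pivot (x zero + v * dot row (x ∘ suc)) (form (schur v) (x ∘ suc)) (x zero))

      -- The first coordinate is chosen to kill the square, so the form takes its Schur value.
      lift-negative : ∀ z → form (schur v) z < 0# → Negative M
      lift-negative z q<0 = - (v * dot row z) ∷ z , <-resp (sym (trans
        (square (- (v * dot row z) ∷ z))
        (solve 3 (λ m a q → m :* ((:- a :+ a) :* (:- a :+ a)) :+ q := q) refl
          pivot (v * dot row z) (form (schur v) z)))) refl q<0

      -- Back substitution: the first coordinate solves the first equation, and inserting it turns
      -- the other equations into those of the Schur complement.
      lift-singular : ∀ z → (∃ λ i → z i # 0#) → (∀ i → (schur v · z) i ≈ 0#) → Singular M
      lift-singular z (i , zᵢ#0) Sz≈0 = - (v * s) ∷ z , (suc i , zᵢ#0) , λ where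
          zero    → begin
            pivot * - (v * s) + s
              ≈⟨ solve 3 (λ m v s → m :* :- (v :* s) :+ s := :- ((m :* v) :* s) :+ s) refl pivot v s ⟩
            - ((pivot * v) * s) + s ≈⟨ +-congʳ (-‿cong (*-congʳ mv≈1)) ⟩
            - (1# * s) + s          ≈⟨ solve 1 (λ s → :- (con (+ 1) :* s) :+ s := con (+ 0)) refl s ⟩
            0#                      ∎
          (suc i) → begin
            M (suc i) zero * - (v * s) + (minor · z) i ≈⟨ +-congʳ (*-congʳ (M-sym (suc i) zero)) ⟩
            row i * - (v * s) + (minor · z) i
              ≈⟨ solve 4 (λ r v s a → r :* :- (v :* s) :+ a := a :- v :* r :* s) refl
                   (row i) v s ((minor · z) i) ⟩
            (minor · z) i - v * row i * s              ≈⟨ schur-· v z i ⟨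
            (schur v · z) i                            ≈⟨ Sz≈0 i ⟩
            0#                                         ∎
        where s = dot row z

      -- With r = t + v s, t² ≤ 2 r² + 2 v² s² = 2 v (m r²) + 2 v² s², and s² ≤ C |z|².
      lift-coercive : Coercive (schur v) → Coercive M
      lift-coercive (K , 0≤K , coercive) with dot-bounded row
      ... | C , 0≤C , s²≤ = (v + v) + G * K , 0≤+ (<⇒≤ (0<+ 0<v (<⇒≤ 0<v))) (0≤* 0≤G 0≤K) , λ x →
          let t = x zero; z = x ∘ suc; s = dot row z; N = normSq z; q = form (schur v) z
              r = t + v * s
              0≤q = proj₁ (coercive z)
              0≤mr² = 0≤* (<⇒≤ 0<m) (0≤sq r)
          in
          0≤-resp (sym (square x)) (0≤+ 0≤mr² 0≤q) ,
          0≤-resp (begin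
              (v + v) * q + (G * K) * (pivot * (r * r)) + G * (K * q - N)
                + (v * v + v * v) * (C * N - s * s) + (r + v * s) * (r + v * s)
                ≈⟨ solve 8 (λ m v C K t s q N →
                     let r = t :+ v :* s
                         G = (v :* v :+ v :* v) :* C :+ con (+ 1)
                     in
                     (v :+ v) :* q :+ (G :* K) :* (m :* (r :* r)) :+ G :* (K :* q :- N)
                       :+ (v :* v :+ v :* v) :* (C :* N :- s :* s) :+ (r :+ v :* s) :* (r :+ v :* s)
                     := (v :+ v) :* q :+ (G :* K) :* (m :* (r :* r) :+ q)
                       :+ con (+ 1) :* (r :* r :+ r :* r) :- (t :* t :+ N)) refl pivot v C K t s q N ⟩
              (v + v) * q + (G * K) * (pivot * (r * r) + q) + 1# * (r * r + r * r) - (t * t + N)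
                ≈⟨ +-congʳ (+-congˡ (*-congʳ mv≈1)) ⟨
              (v + v) * q + (G * K) * (pivot * (r * r) + q) + (pivot * v) * (r * r + r * r) - (t * t + N)
                ≈⟨ solve 7 (λ m v r q t N GK →
                     (v :+ v) :* q :+ GK :* (m :* (r :* r) :+ q) 
                       :+ (m :* v) :* (r :* r :+ r :* r) :- (t :* t :+ N)
                     := ((v :+ v) :+ GK) :* (m :* (r :* r) :+ q) :- (t :* t :+ N)) refl
                     pivot v r q t N (G * K) ⟩
              ((v + v) + G * K) * (pivot * (r * r) + q) - (t * t + N)
                ≈⟨ +-congʳ (*-congˡ (square x)) ⟨
              ((v + v) + G * K) * form M x - normSq x ∎)
            (0≤+ (0≤+ (0≤+ (0≤+ (0≤* (<⇒≤ (0<+ 0<v (<⇒≤ 0<v))) 0≤q)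
              (0≤* (0≤* 0≤G 0≤K) 0≤mr²))
              (0≤* 0≤G (proj₂ (coercive z))))
              (0≤* (0≤+ (0≤sq v) (0≤sq v)) (s²≤ z)))
              (0≤sq (r + v * s)))
        where
        -- The coefficient of `N`: one for `N` itself and `2 v² C` from the bound on `t²`. Then
        -- `N ≤ K q` leads to the constant `2 v + G K`.
        G = (v * v + v * v) * C + 1#
        0≤G = 0≤+ (0≤* (0≤+ (0≤sq v) (0≤sq v)) 0≤C) (<⇒≤ 0<1)

-- The Rayleigh bound for the largest eigenvalue.

module Rayleigh {c ℓ₁ ℓ₂ : Level} (ℝ : Reals c ℓ₁ ℓ₂) where
  open Reals ℝ hiding (zero)
  open Spectral ℝ
  open IntegerCoefficientSolver commutativeRing
  open OrderProperties ℝ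
  open QuadraticForms ℝ
  open Definiteness ℝ
  open SetoidReasoning setoid

  private variable
    n : ℕ

  basis-sym : ∀ (i j : Fin n) → basis i j ≈ basis j i
  basis-sym zero    zero    = refl
  basis-sym zero    (suc j) = refl
  basis-sym (suc i) zero    = refl
  basis-sym (suc i) (suc j) = basis-sym i j

  -- This is `μ I - A`, with `basis i` as row `i` of the identity.
  shift : Carrier → Matrix n → Matrix n
  shift μ A i = comb μ (basis i) (- 1#) (A i)

  shift-sym : ∀ μ (A : Matrix n) → Symmetric A → Symmetric (shift μ A)
  shift-sym μ A A-sym i j = +-cong (*-congˡ (basis-sym i j)) (*-congˡ (A-sym i j))

  shift-· : ∀ μ (A : Matrix n) x i → (shift μ A · x) i ≈ μ * x i + - 1# * (A · x) i
  shift-· μ A x i = trans (dot-combˡ μ (basis i) (- 1#) (A i) x) (+-congʳ (*-congˡ (dot-basisˡ i x)))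

  form-shift : ∀ μ (A : Matrix n) x → form (shift μ A) x ≈ μ * normSq x - form A x
  form-shift μ A x = trans (dot-cong {b = x} (λ _ → refl) (shift-· μ A x))
    (trans (dot-combʳ x μ x (- 1#) (A · x))
      (solve 3 (λ μ N q → μ :* N :+ :- con (+ 1) :* q := μ :* N :- q) refl μ (normSq x) (form A x)))

  -- As `N` may be zero, the step up from `a` is `(q - a N) / (1 + N)`; the room then left,
  -- `q - t N`, is that same positive number.
  room-above : ∀ {a N q} → 0# ≤ N → a * N < q → ∃ λ t → a < t × t * N < q
  room-above {a} {N} {q} 0≤N aN<q =
    let w , 0<w , [1+N]w≈1 = 0<⇒inverse (0<+ 0<1 0≤N)
        0<dw = *-pos (<⇒0<- aN<q) 0<w
    in a + (q - a * N) * w , <-resp (+-identityʳ a) refl (+-monoʳ-< a 0<dw) ,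
       0<-⇒< (0<-resp (gap [1+N]w≈1) 0<dw)
    where
    gap : ∀ {w} → (1# + N) * w ≈ 1# → (q - a * N) * w ≈ q - (a + (q - a * N) * w) * N
    gap {w} [1+N]w≈1 = begin
      (q - a * N) * w
        ≈⟨ solve 2 (λ d w → d :* w := d :- d :* con (+ 1) :+ d :* w) refl (q - a * N) w ⟩
      (q - a * N) - (q - a * N) * 1# + (q - a * N) * w
        ≈⟨ +-congʳ (+-congˡ (-‿cong (*-congˡ [1+N]w≈1))) ⟨
      (q - a * N) - (q - a * N) * ((1# + N) * w) + (q - a * N) * w
        ≈⟨ solve 4 (λ q a N w → let d = q :- a :* N in
             d :- d :* ((con (+ 1) :+ N) :* w) :+ d :* w := q :- (a :+ d :* w) :* N) refl q a N w ⟩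
      q - (a + (q - a * N) * w) * N ∎

  module _ (A : Matrix n) (A-sym : Symmetric A) where

    -- The numbers strictly below some Rayleigh quotient, written without division so that `y` need
    -- not be apart from zero. `Lift` only adjusts the universe level to that of `supremum`.
    Subquotient : Pred Carrier (c ⊔ ℓ₁ ⊔ ℓ₂)
    Subquotient t = Lift (c ⊔ ℓ₁ ⊔ ℓ₂) (∃ λ y → t * normSq y < form A y)

    subquotient-above : ∀ a y → a * normSq y < form A y → HasElementAbove Subquotient a
    subquotient-above a y aN<q =
      let t , a<t , tN<q = room-above (0≤normSq y) aN<q in t , lift (y , tN<q) , a<t

    form-bound⇒upperBound : ∀ b → (∀ y → 0# ≤ b * normSq y - form A y) → UpperBound Subquotient b
    form-bound⇒upperBound b bound s (lift (y , sN<q)) b<s =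
      0≤-resp (solve 4 (λ b s N q → (s :- b) :* N :+ (b :* N :- q) := :- (q :- s :* N)) refl
          b s (normSq y) (form A y))
        (0≤+ (0≤* (<⇒≤ (<⇒0<- b<s)) (0≤normSq y)) (bound y))
        (0<-⇒<0 (0<-resp (solve 1 (λ a → a := :- :- a) refl (form A y - s * normSq y)) (<⇒0<- sN<q)))

    -- Perturbed elimination of `a I - A` with `ε = b - a`: a negative value yields an element above
    -- `a`, and otherwise the slack `ε |y|²` raises the bound from `a` to `b`.
    located : Located Subquotient
    located a b a<b =
      case negative-or-almost-nonnegative (shift a A) (shift-sym a A A-sym) (<⇒0<- a<b) of λ where
        (inj₁ (y , q<0)) → inj₁ (subquotient-above a y
            (0<-⇒< (0<-resp (solve 2 (λ aN q → :- (aN :- q) := q :- aN) refl (a * normSq y) (form A y))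
              (<0⇒0<- (<-resp (form-shift a A y) refl q<0)))))
        (inj₂ 0≤q) → inj₂ (form-bound⇒upperBound b λ y →
            0≤-resp (trans (+-congʳ (form-shift a A y))
              (solve 4 (λ a b N q → a :* N :- q :+ (b :- a) :* N := b :* N :- q) refl
                a b (normSq y) (form A y)))
              (0≤q y))

    -- Adding `0 ≤ f` to `|y|² ≤ K f` gives `|y|² ≤ (1 + K) f`, where `1 + K` is certainly
    -- invertible. Hence `μ` can be lowered by `w = 1 / (1 + K)`.
    coercive⇒upperBound-below : ∀ μ → Coercive (shift μ A) → ∃ λ a → a < μ × UpperBound Subquotient a
    coercive⇒upperBound-below μ (K , 0≤K , coercive) =
      let w , 0<w , [1+K]w≈1 = 0<⇒inverse (0<+ 0<1 0≤K) in
        μ - w , 0<-⇒< (0<-resp (solve 2 (λ μ w → w := μ :- (μ :- w)) refl μ w) 0<w) ,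
        form-bound⇒upperBound (μ - w) λ y →
          let N = normSq y; f = form (shift μ A) y; q = form A y in
          0≤-resp (begin
              w * (f + (K * f - N))   ≈⟨ solve 4 (λ w f K N → w :* (f :+ (K :* f :- N))
                                           := ((con (+ 1) :+ K) :* w) :* f :- w :* N) refl w f K N ⟩
              ((1# + K) * w) * f - w * N ≈⟨ +-congʳ (*-cong [1+K]w≈1 (form-shift μ A y)) ⟩
              1# * (μ * N - q) - w * N   ≈⟨ solve 4 (λ μ N q w → con (+ 1) :* (μ :* N :- q) :- w :* N
                                           := (μ :- w) :* N :- q) refl μ N q w ⟩
              (μ - w) * N - q ∎)
            (0≤* (<⇒≤ 0<w) (0≤+ (proj₁ (coercive y)) (proj₂ (coercive y))))

    singular⇒eigenvalue : ∀ μ → Singular (shift μ A) → IsEigenvalue A μ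
    singular⇒eigenvalue μ (y , y#0 , Sy≈0) = y , y#0 , λ i → begin
      (A · y) i
        ≈⟨ solve 2 (λ a b → a := b :- (b :+ :- con (+ 1) :* a)) refl ((A · y) i) (μ * y i) ⟩
      μ * y i - (μ * y i + - 1# * (A · y) i)
        ≈⟨ +-congˡ (-‿cong (trans (sym (shift-· μ A y i)) (Sy≈0 i))) ⟩
      μ * y i - 0#
        ≈⟨ solve 1 (λ a → a :- con (+ 0) := a) refl (μ * y i) ⟩
      μ * y i ∎

    rayleigh : ∀ {lam} → (∀ ν → IsEigenvalue A ν → ν ≤ lam) → ∀ y → form A y ≤ lam * normSq y
    rayleigh {lam} largest y lamN<q =
      -- The goal is falsity, so the doubly negated trichotomy can be used directly.
      definiteness-trichotomy (shift μ A) (shift-sym μ A A-sym) λ where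
        (inj₁ (z , f<0)) → case subquotient-above μ z
            (0<-⇒< (0<-resp (solve 2 (λ μN q → :- (μN :- q) := q :- μN) refl (μ * normSq z) (form A z))
              (<0⇒0<- (<-resp (form-shift μ A z) refl f<0)))) of λ where
          (t , t∈S , μ<t) → upper t t∈S μ<t
        (inj₂ (inj₁ singular)) → largest μ (singular⇒eigenvalue μ singular)
          (<-≤-trans lam<t (upper t t∈S))
        (inj₂ (inj₂ coercive)) → case coercive⇒upperBound-below μ coercive of λ where
          (a , a<μ , bound) → case approximable a a<μ of λ where
            (s , s∈S , a<s) → bound s s∈S a<s
      where
      -- The violating `y` yields an element above `lam`; it makes the set inhabited and forces
      -- `lam < μ`.
      above = subquotient-above lam y lamN<q
      t = proj₁ above
      t∈S = proj₁ (proj₂ above)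
      lam<t = proj₂ (proj₂ above)
      bounded = form-bounded A A-sym
      sup = supremum Subquotient (t , t∈S)
        (proj₁ bounded , form-bound⇒upperBound (proj₁ bounded) (proj₂ (proj₂ bounded))) located
      μ = proj₁ sup
      upper = proj₁ (proj₂ sup)
      approximable = proj₂ (proj₂ sup)

  adjacency-sym : (Γ : SignedGraph n) → Symmetric (adjacency Γ)
  adjacency-sym Γ i j = reflexive (≡.cong (maybe′ fromSign 0#) (SignedGraph.label-sym Γ i j))

  adjacency-diag : ∀ (Γ : SignedGraph n) i → adjacency Γ i i ≈ 0#
  adjacency-diag Γ i = reflexive (≡.cong (maybe′ fromSign 0#) (SignedGraph.label-irrefl Γ i))

  -- The diagonal is zero, so the Rayleigh bound at a basis vector reads `0# ≤ lam`.
  index-nonnegative : ∀ (Γ : SignedGraph n) {lam} → IsIndex Γ lam → Fin n → 0# ≤ lam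
  index-nonnegative Γ {lam} (_ , largest) i = 0≤-resp
    (trans (+-cong
        (trans (*-congˡ (trans (dot-basisˡ i (basis i)) (basis-diag i))) (*-identityʳ lam))
        (-‿cong (trans (form-basis (adjacency Γ) i) (adjacency-diag Γ i))))
      (solve 1 (λ l → l :- con (+ 0) := l) refl lam))
    (≤⇒0≤- (rayleigh (adjacency Γ) (adjacency-sym Γ) largest (basis i)))

-- The α-transform as a rank-two update of the adjacency matrix.

data RoleView {n} (u v : Fin n) : Fin n → Role → Set where
  at-u      : RoleView u v u is-u
  at-v      : RoleView u v v is-v
  elsewhere : ∀ {x} → x ≢ u → x ≢ v → RoleView u v x other

-- Matching on the view identifies `x` with `u` or `v`, or keeps both disequalities, at the same
-- time as it fixes the role.
roleView : ∀ {n} (u v x : Fin n) → RoleView u v x (role u v x)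
roleView u v x with x ≟ u | x ≟ v
... | yes ≡.refl | _          = at-u
... | no x≢u     | yes ≡.refl = at-v
... | no x≢u     | no x≢v     = elsewhere x≢u x≢v

module AlphaForm {c ℓ₁ ℓ₂ : Level} (ℝ : Reals c ℓ₁ ℓ₂) {n : ℕ} (Γ : SignedGraph n) (u v : Fin n)
                 (uv-edge : SignedGraph.Edge Γ u v) (no-triangle : SignedGraph.InNoTriangle Γ u v) where
  open Reals ℝ hiding (zero)
  open Spectral ℝ
  open IntegerCoefficientSolver commutativeRing
  open QuadraticForms ℝ
  open Rayleigh ℝ
  open SetoidReasoning setoid
  open SignedGraph Γ
  open AlphaTransform Γ u v using (label′)

  weight : Maybe Sign → Carrier
  weight = maybe′ fromSign 0#

  -- One of the two weights is zero. Through this, the absence of triangles on `uv` makes the merged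
  -- row at `u` a sum of two rows.
  weight-<∣> : ∀ {p q} → ¬ (Is-just p × Is-just q) → weight (p <∣> q) ≈ weight p + weight q
  weight-<∣> {just _}  {just _}  ¬both = contradiction (just tt , just tt) ¬both
  weight-<∣> {just _}  {nothing} ¬both = sym (+-identityʳ _)
  weight-<∣> {nothing} {q}       ¬both = sym (+-identityˡ _)

  A A′ : Matrix n
  A  = adjacency Γ
  A′ = adjacency (α Γ u v)

  A-sym : Symmetric A
  A-sym = adjacency-sym Γ

  A-diag : ∀ i → A i i ≈ 0#
  A-diag = adjacency-diag Γ

  u≢v : u ≢ v
  u≢v u≡v = case ≡.subst Is-just (≡.trans (≡.cong (label u) (≡.sym u≡v)) (label-irrefl u)) uv-edge of λ ()

  -- `ends` and `moved` are the vectors `d` and `r`; in `moved` the multiple of `basis u` cancels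
  -- the entry of row `v` at `u`. Below, `end` and `move` give their entries by role, so the update
  -- can be checked by cases.
  ends : Vector Carrier n
  ends = comb 1# (basis u) (- 1#) (basis v)

  moved : Vector Carrier n
  moved = comb 1# (A v) (- A v u) (basis u)

  end : Role → Carrier
  end is-u  = 1#
  end is-v  = - 1#
  end other = 0#

  move : Role → Fin n → Carrier
  move is-u  x = 0#
  move is-v  x = 0#
  move other x = A v x

  ends≈end : ∀ {x r} → RoleView u v x r → ends x ≈ end r
  ends≈end at-u = trans (+-cong (*-congˡ (basis-diag u)) (*-congˡ (basis-off (u≢v ∘ ≡.sym))))
    (solve 0 (con (+ 1) :* con (+ 1) :+ :- con (+ 1) :* con (+ 0) := con (+ 1)) refl)
  ends≈end at-v = trans (+-cong (*-congˡ (basis-off u≢v)) (*-congˡ (basis-diag v)))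
    (solve 0 (con (+ 1) :* con (+ 0) :+ :- con (+ 1) :* con (+ 1) := :- con (+ 1)) refl)
  ends≈end (elsewhere x≢u x≢v) = trans
    (+-cong (*-congˡ (basis-off (x≢u ∘ ≡.sym))) (*-congˡ (basis-off (x≢v ∘ ≡.sym))))
    (solve 0 (con (+ 1) :* con (+ 0) :+ :- con (+ 1) :* con (+ 0) := con (+ 0)) refl)

  moved≈move : ∀ {x r} → RoleView u v x r → moved x ≈ move r x
  moved≈move at-u = trans (+-congˡ (*-congˡ (basis-diag u)))
    (solve 1 (λ a → con (+ 1) :* a :+ :- a :* con (+ 1) := con (+ 0)) refl (A v u))
  moved≈move at-v = trans (+-cong (*-congˡ (A-diag v)) (*-congˡ (basis-off u≢v)))
    (solve 1 (λ a → con (+ 1) :* con (+ 0) :+ :- a :* con (+ 0) := con (+ 0)) refl (A v u))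
  moved≈move {x} (elsewhere x≢u x≢v) = trans (+-congˡ (*-congˡ (basis-off (x≢u ∘ ≡.sym))))
    (solve 2 (λ b a → con (+ 1) :* b :+ :- a :* con (+ 0) := b) refl (A v x) (A v u))

  -- Away from `u` and `v`, the update adds row `v` to row `u` and cancels row `v`, and likewise for
  -- columns; the entries among `u` and `v` stay fixed. The absence of triangles enters when exactly
  -- one index is `u` and the other is `elsewhere`.
  label′-weight : ∀ {i j r s} → RoleView u v i r → RoleView u v j s →
    weight (label′ r s i j) ≈ A i j + (end r * move s j + move r i * end s)
  label′-weight at-u at-u = trans (sym (A-diag u))
    (solve 1 (λ a → a := a :+ (con (+ 1) :* con (+ 0) :+ con (+ 0) :* con (+ 1))) refl (A u u))
  label′-weight at-u at-v =
    solve 1 (λ a → a := a :+ (con (+ 1) :* con (+ 0) :+ con (+ 0) :* :- con (+ 1))) refl (A u v)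
  label′-weight {j = j} at-u (elsewhere _ _) = trans
    (weight-<∣> λ (uj , vj) → no-triangle j (uj , ≡.subst Is-just (label-sym v j) vj))
    (solve 2 (λ a b → a :+ b := a :+ (con (+ 1) :* b :+ con (+ 0) :* con (+ 0))) refl (A u j) (A v j))
  label′-weight at-v at-u =
    solve 1 (λ a → a := a :+ (:- con (+ 1) :* con (+ 0) :+ con (+ 0) :* con (+ 1))) refl (A v u)
  label′-weight at-v at-v = trans (sym (A-diag v))
    (solve 1 (λ a → a := a :+ (:- con (+ 1) :* con (+ 0) :+ con (+ 0) :* :- con (+ 1))) refl (A v v))
  label′-weight {j = j} at-v (elsewhere _ _) =
    solve 1 (λ a → con (+ 0) := a :+ (:- con (+ 1) :* a :+ con (+ 0) :* con (+ 0))) refl (A v j)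
  label′-weight {i} (elsewhere _ _) at-u = trans
    (weight-<∣> λ (iu , iv) → no-triangle i (≡.subst Is-just (label-sym i u) iu , iv))
    (trans (+-congˡ (A-sym i v))
      (solve 2 (λ a b → a :+ b := a :+ (con (+ 0) :* con (+ 0) :+ b :* con (+ 1))) refl (A i u) (A v i)))
  label′-weight {i} (elsewhere _ _) at-v = trans
    (solve 1 (λ a → con (+ 0) := a :+ (con (+ 0) :* con (+ 0) :+ a :* :- con (+ 1))) refl (A v i))
    (+-congʳ (A-sym v i))
  label′-weight {i} {j} (elsewhere _ _) (elsewhere _ _) =
    solve 3 (λ a b d → a := a :+ (con (+ 0) :* b :+ d :* con (+ 0))) refl (A i j) (A v j) (A v i)

  A′-entry : ∀ i j → A′ i j ≈ A i j + (ends i * moved j + moved i * ends j)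
  A′-entry i j = trans (label′-weight i-view j-view) (sym (+-congˡ
    (+-cong (*-cong (ends≈end i-view) (moved≈move j-view)) (*-cong (moved≈move i-view) (ends≈end j-view)))))
    where
    i-view = roleView u v i
    j-view = roleView u v j

  dot-ends : ∀ y → dot ends y ≈ y u - y v
  dot-ends y = trans (dot-combˡ 1# (basis u) (- 1#) (basis v) y)
    (trans (+-cong (*-congˡ (dot-basisˡ u y)) (*-congˡ (dot-basisˡ v y)))
      (solve 2 (λ a b → con (+ 1) :* a :+ :- con (+ 1) :* b := a :- b) refl (y u) (y v)))

  dot-moved : ∀ y → dot moved y ≈ (A · y) v - A v u * y u
  dot-moved y = trans (dot-combˡ 1# (A v) (- A v u) (basis u) y)
    (trans (+-congˡ (*-congˡ (dot-basisˡ u y)))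
      (solve 3 (λ a b d → con (+ 1) :* a :+ :- b :* d := a :- b :* d) refl ((A · y) v) (A v u) (y u)))

  form-A′ : ∀ y → let g = (y u - y v) * ((A · y) v - A v u * y u) in
            form A′ y ≈ form A y + (g + g)
  form-A′ y = begin
    form A′ y
      ≈⟨ dot-cong {b = y} (λ _ → refl) A′y≈ ⟩
    dot y (comb 1# (A · y) 1# (comb ρ ends η moved))
      ≈⟨ dot-combʳ y 1# (A · y) 1# (comb ρ ends η moved) ⟩
    1# * form A y + 1# * dot y (comb ρ ends η moved)
      ≈⟨ +-congˡ (*-congˡ (dot-combʳ y ρ ends η moved)) ⟩
    1# * form A y + 1# * (ρ * dot y ends + η * dot y moved)
      ≈⟨ +-congˡ (*-congˡ (+-cong (*-congˡ (dot-comm y ends)) (*-congˡ (dot-comm y moved)))) ⟩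
    1# * form A y + 1# * (ρ * η + η * ρ)
      ≈⟨ solve 3 (λ q ρ η → con (+ 1) :* q :+ con (+ 1) :* (ρ :* η :+ η :* ρ)
           := q :+ (η :* ρ :+ η :* ρ)) refl (form A y) ρ η ⟩
    form A y + (η * ρ + η * ρ)
      ≈⟨ +-congˡ (+-cong (*-cong (dot-ends y) (dot-moved y)) (*-cong (dot-ends y) (dot-moved y))) ⟩
    form A y + ((y u - y v) * ((A · y) v - A v u * y u) + (y u - y v) * ((A · y) v - A v u * y u)) ∎
    where
    ρ = dot moved y
    η = dot ends y
    A′y≈ : ∀ i → (A′ · y) i ≈ comb 1# (A · y) 1# (comb ρ ends η moved) i
    A′y≈ i = begin
      (A′ · y) i
        ≈⟨ dot-cong {y = y} (λ j → trans (A′-entry i j)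
             (sym (+-cong (*-identityˡ _) (*-identityˡ _)))) (λ _ → refl) ⟩
      dot (comb 1# (A i) 1# (comb (ends i) moved (moved i) ends)) y
        ≈⟨ dot-combˡ 1# (A i) 1# (comb (ends i) moved (moved i) ends) y ⟩
      1# * (A · y) i + 1# * dot (comb (ends i) moved (moved i) ends) y
        ≈⟨ +-congˡ (*-congˡ (dot-combˡ (ends i) moved (moved i) ends y)) ⟩
      1# * (A · y) i + 1# * (ends i * ρ + moved i * η)
        ≈⟨ +-congˡ (*-congˡ (+-cong (*-comm _ _) (*-comm _ _))) ⟩
      1# * (A · y) i + 1# * (ρ * ends i + η * moved i) ∎

  -- The two test vectors: the eigenvector and its swap.

  module Eigenvector (lam : Carrier) (x : Vector Carrier n) (Ax≈ : ∀ i → (A · x) i ≈ lam * x i) where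

    form-eigenvector : form A x ≈ lam * normSq x
    form-eigenvector = begin
      dot x (A · x)
        ≈⟨ dot-cong {b = x} (λ _ → refl) (λ i → trans (Ax≈ i)
             (solve 2 (λ l a → l :* a := l :* a :+ con (+ 0) :* a) refl lam (x i))) ⟩
      dot x (comb lam x 0# x)
        ≈⟨ dot-combʳ x lam x 0# x ⟩
      lam * normSq x + 0# * normSq x
        ≈⟨ solve 2 (λ l N → l :* N :+ con (+ 0) :* N := l :* N) refl lam (normSq x) ⟩
      lam * normSq x ∎

    form-A′-eigenvector : let g = (x u - x v) * (lam * x v - A v u * x u) in
                          form A′ x ≈ lam * normSq x + (g + g)
    form-A′-eigenvector = trans (form-A′ x) (+-cong form-eigenvector (+-cong gain gain))
      where
      gain : (x u - x v) * ((A · x) v - A v u * x u) ≈ (x u - x v) * (lam * x v - A v u * x u)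
      gain = *-congˡ (+-congʳ (Ax≈ v))

    -- x with its entries at u and v interchanged
    swapped : Vector Carrier n
    swapped = comb 1# x (x v - x u) ends

    k : Carrier
    k = x v - x u

    swapped-u : swapped u ≈ x v
    swapped-u = trans (+-congˡ (*-congˡ (ends≈end at-u)))
      (solve 2 (λ a b → con (+ 1) :* a :+ (b :- a) :* con (+ 1) := b) refl (x u) (x v))

    swapped-v : swapped v ≈ x u
    swapped-v = trans (+-congˡ (*-congˡ (ends≈end at-v)))
      (solve 2 (λ a b → con (+ 1) :* b :+ (b :- a) :* :- con (+ 1) := a) refl (x u) (x v))

    -- With `d` for `ends`, `d · x = - k` and `d · swapped = k`, so the two increments in the
    -- expansion of `x + k d` cancel.
    normSq-swapped : normSq swapped ≈ normSq x
    normSq-swapped = begin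
      dot swapped swapped
        ≈⟨ dot-combʳ swapped 1# x k ends ⟩
      1# * dot swapped x + k * dot swapped ends
        ≈⟨ +-cong (*-congˡ (dot-combˡ 1# x k ends x))
                  (*-congˡ (trans (dot-comm swapped ends) (dot-ends swapped))) ⟩
      1# * (1# * normSq x + k * dot ends x) + k * (swapped u - swapped v)
        ≈⟨ +-cong (*-congˡ (+-congˡ (*-congˡ (dot-ends x))))
                  (*-congˡ (+-cong swapped-u (-‿cong swapped-v))) ⟩
      1# * (1# * normSq x + k * (x u - x v)) + k * (x v - x u)
        ≈⟨ solve 3 (λ N a b → con (+ 1) :* (con (+ 1) :* N :+ (b :- a) :* (a :- b)) :+ (b :- a) :* (b :- a)
             := N) refl (normSq x) (x u) (x v) ⟩
      normSq x ∎

    A·swapped : ∀ i → (A · swapped) i ≈ lam * x i + k * (A i u - A i v)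
    A·swapped i = begin
      dot (A i) swapped
        ≈⟨ dot-combʳ (A i) 1# x k ends ⟩
      1# * (A · x) i + k * dot (A i) ends
        ≈⟨ +-cong (trans (*-identityˡ _) (Ax≈ i)) (*-congˡ (trans (dot-comm (A i) ends) (dot-ends (A i)))) ⟩
      lam * x i + k * (A i u - A i v) ∎

    -- Symmetry moves `A` from `swapped` onto `x`, after which only the eigenvalue equation and the
    -- entries of `A` at `u` and `v` are involved.
    form-swapped : form A swapped ≈
      lam * normSq x + k * (lam * (x u - x v)) + k * (lam * (x u - x v) - k * (A u v + A u v))
    form-swapped = begin
      dot swapped (A · swapped)
        ≈⟨ dot-combˡ 1# x k ends (A · swapped) ⟩
      1# * dot x (A · swapped) + k * dot ends (A · swapped)
        ≈⟨ +-cong (*-congˡ (dot-symmetric A A-sym x swapped)) (*-congˡ (dot-ends (A · swapped))) ⟩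
      1# * dot swapped (A · x) + k * ((A · swapped) u - (A · swapped) v)
        ≈⟨ +-cong (*-congˡ (dot-combˡ 1# x k ends (A · x)))
             (*-congˡ (+-cong (A·swapped u) (-‿cong (A·swapped v)))) ⟩
      1# * (1# * form A x + k * dot ends (A · x))
        + k * (lam * x u + k * (A u u - A u v) - (lam * x v + k * (A v u - A v v)))
        ≈⟨ +-cong
             (*-congˡ (+-cong (*-congˡ form-eigenvector)
               (*-congˡ (trans (dot-ends (A · x)) (+-cong (Ax≈ u) (-‿cong (Ax≈ v)))))))
             (*-congˡ (+-cong (+-congˡ (*-congˡ (+-congʳ (A-diag u))))
               (-‿cong (+-congˡ (*-congˡ (+-cong (A-sym v u) (-‿cong (A-diag v)))))))) ⟩
      1# * (1# * (lam * normSq x) + k * (lam * x u - lam * x v))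
        + k * (lam * x u + k * (0# - A u v) - (lam * x v + k * (A u v - 0#)))
        ≈⟨ solve 6 (λ l N k a b e →
             con (+ 1) :* (con (+ 1) :* (l :* N) :+ k :* (l :* a :- l :* b))
               :+ k :* (l :* a :+ k :* (con (+ 0) :- e) :- (l :* b :+ k :* (e :- con (+ 0))))
             := l :* N :+ k :* (l :* (a :- b)) :+ k :* (l :* (a :- b) :- k :* (e :+ e)))
             refl lam (normSq x) k (x u) (x v) (A u v) ⟩
      lam * normSq x + k * (lam * (x u - x v)) + k * (lam * (x u - x v) - k * (A u v + A u v)) ∎

    -- Interchanging `u` and `v` in `Γ′` gives the transform that moves the edges at `u` to `v`. The
    -- gain is therefore the one for `x` with the roles of `u` and `v` exchanged.
    form-A′-swapped : let g = (x v - x u) * (lam * x u - A v u * x v) in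
                      form A′ swapped ≈ lam * normSq x + (g + g)
    form-A′-swapped = begin
      form A′ swapped
        ≈⟨ form-A′ swapped ⟩
      form A swapped + (gain + gain)
        ≈⟨ +-cong form-swapped (+-cong gain≈ gain≈) ⟩
      lam * normSq x + k * (lam * (x u - x v)) + k * (lam * (x u - x v) - k * (A u v + A u v))
        + (gain′ + gain′)
        ≈⟨ +-congʳ (+-congˡ (*-congˡ (+-congˡ (-‿cong (*-congˡ (+-cong (A-sym u v) (A-sym u v))))))) ⟩
      lam * normSq x + k * (lam * (x u - x v)) + k * (lam * (x u - x v) - k * (A v u + A v u))
        + (gain′ + gain′)
        ≈⟨ solve 5 (λ l N a b e →
             let k = b :- a
                 g′ = (b :- a) :* ((l :* b :+ k :* (e :- con (+ 0))) :- e :* b)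
                 g = (b :- a) :* (l :* a :- e :* b)
             in l :* N :+ k :* (l :* (a :- b)) :+ k :* (l :* (a :- b) :- k :* (e :+ e)) :+ (g′ :+ g′)
                := l :* N :+ (g :+ g)) refl lam (normSq x) (x u) (x v) (A v u) ⟩
      lam * normSq x + (goal + goal) ∎
      where
      gain  = (swapped u - swapped v) * ((A · swapped) v - A v u * swapped u)
      gain′ = (x v - x u) * ((lam * x v + k * (A v u - 0#)) - A v u * x v)
      goal  = (x v - x u) * (lam * x u - A v u * x v)
      gain≈ : gain ≈ gain′
      gain≈ = *-cong (+-cong swapped-u (-‿cong swapped-v))
        (+-cong (trans (A·swapped v) (+-congˡ (*-congˡ (+-congˡ (-‿cong (A-diag v))))))
          (-‿cong (*-congˡ swapped-u)))

-- From a gain in the form to an inequality of indices.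

module IndexComparison {c ℓ₁ ℓ₂ : Level} (ℝ : Reals c ℓ₁ ℓ₂) where
  open Reals ℝ hiding (zero)
  open Spectral ℝ
  open IntegerCoefficientSolver commutativeRing
  open OrderProperties ℝ
  open QuadraticForms ℝ
  open Rayleigh ℝ

  private variable
    n : ℕ

  -- `N` is separate from `normSq y` so that the swapped vector can be used with the norm of `x`.
  module _ {M : Matrix n} {lam lam′ g N} (bound : ∀ y → form M y ≤ lam′ * normSq y) (0<N : 0# < N)
           (y : Vector Carrier n) (|y|²≈N : normSq y ≈ N) (form≈ : form M y ≈ lam * N + (g + g)) where

    0≤gap : 0# ≤ lam′ * N - (lam * N + (g + g))
    0≤gap = 0≤-resp (+-cong (*-congˡ |y|²≈N) (-‿cong form≈)) (≤⇒0≤- (bound y))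

    -- If `lam′ < lam`, then `(lam - lam′) N + 2 g` would be positive, against `0≤gap`.
    nonnegative-gain : 0# ≤ g → lam ≤ lam′
    nonnegative-gain 0≤g lam′<lam = 0≤gap (0<-⇒<0 (0<-resp
      (solve 4 (λ l l′ g N → (l :- l′) :* N :+ (g :+ g) := :- (l′ :* N :- (l :* N :+ (g :+ g)))) refl
        lam lam′ g N)
      (0<+ (*-pos (<⇒0<- lam′<lam) 0<N) (0≤+ 0≤g 0≤g))))

    -- Here `(lam′ - lam) N` is `2 g` plus the nonnegative gap, and the positive factor `N` cancels.
    positive-gain : 0# < g → lam < lam′
    positive-gain 0<g = 0<-⇒< (*-cancelʳ-0< 0<N (0<-resp
      (solve 4 (λ l l′ g N → g :+ (g :+ (l′ :* N :- (l :* N :+ (g :+ g)))) := (l′ :- l) :* N) refl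
        lam lam′ g N)
      (0<+ 0<g (0≤+ (<⇒≤ 0<g) 0≤gap))))

-- The sign cases for `uv`.

lemma2p5 : ∀ {c ℓ₁ ℓ₂} (ℝ : Reals c ℓ₁ ℓ₂) →
  let open Reals ℝ
      open Spectral ℝ
  in
  ∀ {n : ℕ} (Γ : SignedGraph n) (u v : Fin n) →
  let open SignedGraph Γ
  in
  Connected →
  Edge u v →
  NonPendant u v →
  InNoTriangle u v →
  (λΓ λΓ′ : Carrier) →
  IsIndex Γ λΓ →
  IsIndex (α Γ u v) λΓ′ →
  (x : Vector Carrier n) →
  IsEigenvector (adjacency Γ) λΓ x →
    ( ((label u v ≡ just Sign.+ × x v ≤ x u × x u ≤ λΓ * x v)
        ⊎ (label u v ≡ just Sign.- × 0# ≤ x u × 0# ≤ x v))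
      → λΓ ≤ λΓ′ )
  × ( ((label u v ≡ just Sign.+ × x v < x u × x u < λΓ * x v)
        ⊎ (label u v ≡ just Sign.- × 0# < x u × 0# < x v × x u # x v))
      → λΓ < λΓ′ )
lemma2p5 ℝ {n} Γ u v _ uv-edge _ no-triangle lam lam′ index index′ x (x#0 , Ax≈) = weak , strict
  where
  open Reals ℝ hiding (zero)
  open Spectral ℝ
  open IntegerCoefficientSolver commutativeRing
  open OrderProperties ℝ
  open QuadraticForms ℝ
  open Rayleigh ℝ
  open IndexComparison ℝ
  open SignedGraph Γ
  open AlphaForm ℝ Γ u v uv-edge no-triangle
  open Eigenvector lam x Ax≈

  bound : ∀ y → form A′ y ≤ lam′ * normSq y
  bound = rayleigh A′ (adjacency-sym (α Γ u v)) (proj₂ index′)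

  0<N : 0# < normSq x
  0<N = 0<normSq x x#0

  -- Used when `uv` is negative: it gives the factors `lam * x v + x u` and `lam * x u + x v` their
  -- sign.
  0≤lam : 0# ≤ lam
  0≤lam = index-nonnegative Γ index u

  A-vu : ∀ {s} → label u v ≡ just s → A v u ≈ fromSign s
  A-vu uv≡s = trans (A-sym v u) (reflexive (≡.cong weight uv≡s))

  gain : Carrier
  gain = (x u - x v) * (lam * x v - A v u * x u)

  gain-swapped : Carrier
  gain-swapped = (x v - x u) * (lam * x u - A v u * x v)

  gain⁺ : label u v ≡ just Sign.+ → (x u - x v) * (lam * x v - x u) ≈ gain
  gain⁺ uv⁺ = *-congˡ (+-congˡ (-‿cong (sym (trans (*-congʳ (A-vu uv⁺)) (*-identityˡ (x u))))))

  factor⁻ : label u v ≡ just Sign.- → ∀ a b → lam * b + a ≈ lam * b - A v u * a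
  factor⁻ uv⁻ a b = trans
    (solve 3 (λ l a b → l :* b :+ a := l :* b :- :- con (+ 1) :* a) refl lam a b)
    (+-congˡ (-‿cong (*-congʳ (sym (A-vu uv⁻)))))

  gain⁻ : label u v ≡ just Sign.- → (x u - x v) * (lam * x v + x u) ≈ gain
  gain⁻ uv⁻ = *-congˡ (factor⁻ uv⁻ (x u) (x v))

  gain-swapped⁻ : label u v ≡ just Sign.- → (x v - x u) * (lam * x u + x v) ≈ gain-swapped
  gain-swapped⁻ uv⁻ = *-congˡ (factor⁻ uv⁻ (x v) (x u))

  weak : (label u v ≡ just Sign.+ × x v ≤ x u × x u ≤ lam * x v)
       ⊎ (label u v ≡ just Sign.- × 0# ≤ x u × 0# ≤ x v) → lam ≤ lam′
  weak (inj₁ (uv⁺ , xv≤xu , xu≤lxv)) = nonnegative-gain bound 0<N x refl form-A′-eigenvector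
    (0≤-resp (gain⁺ uv⁺) (0≤* (≤⇒0≤- xv≤xu) (≤⇒0≤- xu≤lxv)))
  -- The goal is a negation, so the sign of `x u - x v` may be split: the swap serves when
  -- `x u < x v`, and `x` itself otherwise.
  weak (inj₂ (uv⁻ , 0≤xu , 0≤xv)) = trichotomous (x u - x v)
    (λ d<0 → nonnegative-gain bound 0<N swapped normSq-swapped form-A′-swapped
      (0≤-resp (gain-swapped⁻ uv⁻) (0≤*
        (<⇒≤ (0<-resp (solve 2 (λ a b → :- (a :- b) := b :- a) refl (x u) (x v)) (<0⇒0<- d<0)))
        (0≤+ (0≤* 0≤lam 0≤xu) 0≤xv))))
    (λ d≈0 → by-x (≈⇒0≤ (sym d≈0)))
    (λ 0<d → by-x (<⇒≤ 0<d))
    where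
    by-x : 0# ≤ x u - x v → lam ≤ lam′
    by-x 0≤d = nonnegative-gain bound 0<N x refl form-A′-eigenvector
      (0≤-resp (gain⁻ uv⁻) (0≤* 0≤d (0≤+ (0≤* 0≤lam 0≤xv) 0≤xu)))

  strict : (label u v ≡ just Sign.+ × x v < x u × x u < lam * x v)
         ⊎ (label u v ≡ just Sign.- × 0# < x u × 0# < x v × x u # x v) → lam < lam′
  strict (inj₁ (uv⁺ , xv<xu , xu<lxv)) = positive-gain bound 0<N x refl form-A′-eigenvector
    (0<-resp (gain⁺ uv⁺) (*-pos (<⇒0<- xv<xu) (<⇒0<- xu<lxv)))
  -- A strict inequality is not a negation; here the apartness decides which test vector to take.
  strict (inj₂ (uv⁻ , 0<xu , 0<xv , xu#xv)) with #⇒<⊎> xu#xv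
  ... | inj₁ xu<xv = positive-gain bound 0<N swapped normSq-swapped form-A′-swapped
    (0<-resp (gain-swapped⁻ uv⁻) (*-pos (<⇒0<- xu<xv)
      (0<-resp (+-comm _ _) (0<+ 0<xv (0≤* 0≤lam (<⇒≤ 0<xu))))))
  ... | inj₂ xv<xu = positive-gain bound 0<N x refl form-A′-eigenvector
    (0<-resp (gain⁻ uv⁻) (*-pos (<⇒0<- xv<xu)
      (0<-resp (+-comm _ _) (0<+ 0<xu (0≤* 0≤lam (<⇒≤ 0<xv))))))
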